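{- Let $\lambda$ be any partition, written in Frobenius notation as $\lambda=(\alpha|\beta)=(\alpha_1\cdots\alpha_r|\beta_1\cdots\beta_r)$, and let $s_{(\alpha|\beta)}=s_\lambda$ be the generalized Schur function of $\lambda$. Then for every $n\ge l(\lambda)$, $$s_{(\alpha|\beta)}=\det\left[s_{(\lambda_i-i\,|\,n-j)}\right]_{1\le i,j\le n}=\det\left[s_{(\alpha_i|\beta_j)}\right]_{1\le i,j\le r},$$ where the entries $s_{(a|b)}$ are the hook Schur functions.
   Context: Setting. Let $B=\mathbb C[h^{(0)}_1,h^{(0)}_2,\dots]$ be the polynomial ring in independent variables $h^{(0)}_k$ ($k>0$), with $h^{(0)}_0=1$ and $h^{(0)}_k=0$ for $k<0$. $B$ is graded by $\deg h^{(0)}_n=n$, and $B^{\le n}$ is the sum of the homogeneous components of degree $\le n$. Let $\{h^{(r)}_k\}_{k,r\in\mathbb Z}$ be a family of elements of $B$ (extending the $h^{(0)}_k$) with $h^{(r)}_k\in B^{\le k+r}$, $h^{(k)}_{ -k}=1$ for all $k\in\mathbb Z$, and $h^{(r)}_k=0$ whenever $k+r<0$. For a partition $\lambda=(\lambda_1\ge\dots\ge\lambda_l\ge0)$ the generalized Schur function is $$s_\lambda=\det\left[h^{(j-1)}_{\lambda_i-i+1}\right]_{1\le i,j\le l}$$ (independent of appending zero parts). It is required that the $s_\lambda$, $\lambda$ ranging over all partitions, form a linear basis of $B$. Generalized elementary symmetric functions: for $a,p\in\mathbb Z$, $e^{(p)}_a=0$ if $p<a$, $e^{(p)}_a=1$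 if $p=a$, and $e^{(p)}_a=\det\left[h^{(-p+j)}_{p+1-i}\right]_{1\le i,j\le p-a}$ if $p>a$. Hook Schur functions: for $m,n\in\mathbb Z$, $$s_{(m|n)}=\sum_{p=0}^{n}(-1)^p\,h^{(p)}_{m+1}\,e^{(-p)}_{ -n}.$$ (For $m,n\ge0$ this is the generalized Schur function $s_{(m+1,1^n)}$ of the hook $(m+1,1^n)$.) Frobenius notation: if $\lambda'$ is the conjugate of $\lambda$ and $r$ is the length of the main diagonal of $\lambda$, then $\alpha_i=\lambda_i-i$ and $\beta_i=\lambda'_i-i$ for $1\le i\le r$. $l(\lambda)$ is the number of nonzero parts, and $\lambda_i=0$ for $i>l(\lambda)$. -}

module Defs where

open import Level using (Level; 0ℓ; _⊔_)
open import Algebra.Bundles using (CommutativeRing)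
open import Data.Fin.Base using (Fin; zero; suc; toℕ; punchIn)
open import Data.Integer.Base as ℤ using (ℤ; +_; +[1+_]; -[1+_]; +0)
open import Data.List.Base using (List; []; _∷_; length; filter; foldr; map; applyUpTo)
open import Data.List.Relation.Unary.All using (All)
open import Data.List.Relation.Unary.Linked using (Linked)
open import Data.List.Relation.Unary.Unique.Propositional using (Unique)
open import Data.Nat.Base as ℕ using (ℕ; zero; suc)
import Data.Nat.Properties as ℕ
open import Data.Product.Base using (_×_; _,_; ∃; proj₁; proj₂)
open import Data.Rational.Base as ℚ using (ℚ; 0ℚ; 1ℚ; ½; Positive; 1/_)
import Data.Rational.Properties as ℚ
import Data.Rational.Solver as ℚ-Solver
open import Relation.Binary.PropositionalEquality as ≡ using (_≡_)
import Algebra.Properties.Semiring.Exp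
import Algebra.Properties.Semiring.Sum

-- `Null s`: the family s tends to 0 along the filter base T 0 ⊇ T 1 ⊇ ….
-- It is used for sequences and (for the Cauchy condition) for double sequences.

module Convergence {I : Set} (T : ℕ → I → Set)
  (antitone : ∀ {M N i} → M ℕ.≤ N → T N i → T M i) where

  record Null (s : I → ℚ) : Set where
    constructor null
    field small : ∀ ε → Positive ε → ∃ λ N → ∀ i → T N i → ℚ.∣ s i ∣ ℚ.< ε

  Bounded : (I → ℚ) → Set
  Bounded s = ∃ λ M → Positive M × ∃ λ N → ∀ i → T N i → ℚ.∣ s i ∣ ℚ.< M

  open Null

  private
    half-sum : ∀ ε → ε ℚ.* ½ ℚ.+ ε ℚ.* ½ ≡ ε
    half-sum ε = ≡.trans (≡.sym (ℚ.*-distribˡ-+ ε ½ ½)) (ℚ.*-identityʳ ε)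

  null-resp : ∀ {s t} → (∀ i → s i ≡ t i) → Null s → Null t
  null-resp s≡t s-null .small ε ε>0 with s-null .small ε ε>0
  ... | N , bound = N , λ i i∈T → ≡.subst (λ q → ℚ.∣ q ∣ ℚ.< ε) (s≡t i) (bound i i∈T)

  null-0 : Null (λ _ → 0ℚ)
  null-0 .small ε ε>0 = 0 , λ _ _ → ℚ.positive⁻¹ ε {{ε>0}}

  null-neg : ∀ {s} → Null s → Null (λ i → ℚ.- s i)
  null-neg {s} s-null .small ε ε>0 with s-null .small ε ε>0
  ... | N , bound = N , λ i i∈T →
    ≡.subst (ℚ._< ε) (≡.sym (ℚ.∣-p∣≡∣p∣ (s i))) (bound i i∈T)

  null-+ : ∀ {s t} → Null s → Null t → Null (λ i → s i ℚ.+ t i)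
  null-+ {s} {t} s-null t-null .small ε ε>0
    with s-null .small (ε ℚ.* ½) ε/2>0 | t-null .small (ε ℚ.* ½) ε/2>0
    where ε/2>0 = ℚ.pos*pos⇒pos ε {{ε>0}} ½
  ... | M , bound₁ | N , bound₂ = M ℕ.⊔ N , λ i i∈T → ≡.subst (_ ℚ.<_) (half-sum ε)
    (ℚ.≤-<-trans (ℚ.∣p+q∣≤∣p∣+∣q∣ (s i) (t i))
      (ℚ.+-mono-< (bound₁ i (antitone (ℕ.m≤m⊔n M N) i∈T))
                  (bound₂ i (antitone (ℕ.m≤n⊔m M N) i∈T))))

  null-* : ∀ {s t} → Bounded s → Null t → Null (λ i → s i ℚ.* t i)
  null-* {s} {t} (B , B>0 , M , bound) t-null .small ε ε>0 = M ℕ.⊔ N , result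
    where
    instance
      _ = B>0
      _ = ℚ.pos⇒nonZero B

    δ : ℚ
    δ = 1/ B ℚ.* ε

    δ>0 : Positive δ
    δ>0 = ℚ.pos*pos⇒pos (1/ B) {{ℚ.1/pos⇒pos B}} ε {{ε>0}}

    N : ℕ
    N = proj₁ (t-null .small δ δ>0)

    Bδ≡ε : B ℚ.* δ ≡ ε
    Bδ≡ε = ≡.trans (≡.sym (ℚ.*-assoc B (1/ B) ε))
      (≡.trans (≡.cong (ℚ._* ε) (ℚ.*-inverseʳ B)) (ℚ.*-identityˡ ε))

    result : ∀ i → T (M ℕ.⊔ N) i → ℚ.∣ s i ℚ.* t i ∣ ℚ.< ε
    result i i∈T = begin-strict
      ℚ.∣ s i ℚ.* t i ∣        ≡⟨ ℚ.∣p*q∣≡∣p∣*∣q∣ (s i) (t i) ⟩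
      ℚ.∣ s i ∣ ℚ.* ℚ.∣ t i ∣  ≤⟨ ℚ.*-monoʳ-≤-nonNeg ℚ.∣ t i ∣ {{ℚ.∣-∣-nonNeg (t i)}}
                                    (ℚ.<⇒≤ (bound i (antitone (ℕ.m≤m⊔n M N) i∈T))) ⟩
      B ℚ.* ℚ.∣ t i ∣          <⟨ ℚ.*-monoʳ-<-pos B
                                    (proj₂ (t-null .small δ δ>0) i
                                      (antitone (ℕ.m≤n⊔m M N) i∈T)) ⟩
      B ℚ.* δ                  ≡⟨ Bδ≡ε ⟩
      ε                        ∎
      where open ℚ.≤-Reasoning

module Seq = Convergence ℕ._≤_ ℕ.≤-trans
module Dbl = Convergence {ℕ × ℕ} (λ N (m , n) → N ℕ.≤ m × N ℕ.≤ n)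
               (λ M≤N (p , q) → ℕ.≤-trans M≤N p , ℕ.≤-trans M≤N q)

Cauchy : (ℕ → ℚ) → Set
Cauchy x = Dbl.Null λ (m , n) → x m ℚ.- x n

-- Equality `_≈ℝ_` below identifies sequences whose difference is null.
record ℝ : Set where
  constructor mkℝ
  field
    seq    : ℕ → ℚ
    cauchy : Cauchy seq

open ℝ

-- A record, so that x and y can be inferred from a proof of x ≈ℝ y.
record _≈ℝ_ (x y : ℝ) : Set where
  constructor null-difference
  field null : Seq.Null (λ n → seq x n ℚ.- seq y n)

private
  module ℚS = ℚ-Solver.+-*-Solver
  open ℚS using (solve; con; _:+_; _:*_; _:-_; :-_; _:=_)

  abstract
    add-diff : ∀ a b → a ℚ.+ (b ℚ.- a) ≡ b
    add-diff = solve 2 (λ a b → a :+ (b :- a) := b) ≡.refl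

    sub-swap : ∀ a b → ℚ.- (a ℚ.- b) ≡ b ℚ.- a
    sub-swap = solve 2 (λ a b → :- (a :- b) := b :- a) ≡.refl

    sub-trans : ∀ a b c → (a ℚ.- b) ℚ.+ (b ℚ.- c) ≡ a ℚ.- c
    sub-trans = solve 3 (λ a b c → (a :- b) :+ (b :- c) := a :- c) ≡.refl

    sub-+ : ∀ a b c d → (a ℚ.- b) ℚ.+ (c ℚ.- d) ≡ (a ℚ.+ c) ℚ.- (b ℚ.+ d)
    sub-+ = solve 4 (λ a b c d → (a :- b) :+ (c :- d) := (a :+ c) :- (b :+ d)) ≡.refl

    sub-* : ∀ a b c d → a ℚ.* (c ℚ.- d) ℚ.+ d ℚ.* (a ℚ.- b) ≡ a ℚ.* c ℚ.- b ℚ.* d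
    sub-* = solve 4 (λ a b c d → a :* (c :- d) :+ d :* (a :- b) := a :* c :- b :* d) ≡.refl

    sub-neg : ∀ a b → ℚ.- (a ℚ.- b) ≡ ℚ.- a ℚ.- ℚ.- b
    sub-neg = solve 2 (λ a b → :- (a :- b) := :- a :- :- b) ≡.refl

    cauchy⇒bounded : ∀ x → Cauchy x → Seq.Bounded x
    cauchy⇒bounded x x-cauchy with x-cauchy .Dbl.Null.small 1ℚ _
    ... | N , close =
      ℚ.∣ x N ∣ ℚ.+ 1ℚ
      , ℚ.nonNeg+pos⇒pos ℚ.∣ x N ∣ {{ℚ.∣-∣-nonNeg (x N)}} 1ℚ
      , N
      , λ n N≤n → ≡.subst (λ q → ℚ.∣ q ∣ ℚ.< ℚ.∣ x N ∣ ℚ.+ 1ℚ) (add-diff (x N) (x n))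
          (ℚ.≤-<-trans (ℚ.∣p+q∣≤∣p∣+∣q∣ (x N) (x n ℚ.- x N))
            (ℚ.+-monoʳ-< ℚ.∣ x N ∣ (close (n , N) (N≤n , ℕ.≤-refl))))

    bounded₁ : ∀ x → Seq.Bounded x → Dbl.Bounded (λ (m , _) → x m)
    bounded₁ x (B , B>0 , N , bound) = B , B>0 , N , λ (m , _) (N≤m , _) → bound m N≤m

    bounded₂ : ∀ x → Seq.Bounded x → Dbl.Bounded (λ (_ , n) → x n)
    bounded₂ x (B , B>0 , N , bound) = B , B>0 , N , λ (_ , n) (_ , N≤n) → bound n N≤n

    cauchy-* : ∀ x y → Cauchy x → Cauchy y → Cauchy (λ n → x n ℚ.* y n)
    cauchy-* x y p q = Dbl.null-resp (λ (m , n) → sub-* (x m) (x n) (y m) (y n))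
      (Dbl.null-+ (Dbl.null-* {s = λ (m , _) → x m} (bounded₁ x (cauchy⇒bounded x p)) q)
                  (Dbl.null-* {s = λ (_ , n) → y n} (bounded₂ y (cauchy⇒bounded y q)) p))

    cauchy-+ : ∀ x y → Cauchy x → Cauchy y → Cauchy (λ n → x n ℚ.+ y n)
    cauchy-+ x y p q = Dbl.null-resp (λ (m , n) → sub-+ (x m) (x n) (y m) (y n)) (Dbl.null-+ p q)

    cauchy-neg : ∀ x → Cauchy x → Cauchy (λ n → ℚ.- x n)
    cauchy-neg x p = Dbl.null-resp (λ (m , n) → sub-neg (x m) (x n)) (Dbl.null-neg p)

    cauchy-const : ∀ q → Cauchy (λ _ → q)
    cauchy-const q = Dbl.null-resp (λ _ → ≡.sym (ℚ.+-inverseʳ q)) Dbl.null-0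

_+ℝ_ _*ℝ_ : ℝ → ℝ → ℝ
mkℝ x p +ℝ mkℝ y q = mkℝ (λ n → x n ℚ.+ y n) (cauchy-+ x y p q)
mkℝ x p *ℝ mkℝ y q = mkℝ (λ n → x n ℚ.* y n) (cauchy-* x y p q)

-ℝ_ : ℝ → ℝ
-ℝ mkℝ x p = mkℝ (λ n → ℚ.- x n) (cauchy-neg x p)

fromℚ : ℚ → ℝ
fromℚ q = mkℝ (λ _ → q) (cauchy-const q)

private
  pointwise : ∀ {x y} → (∀ n → seq x n ≡ seq y n) → x ≈ℝ y
  pointwise {x} {y} x≡y = null-difference (Seq.null-resp
    (λ n → ≡.sym (≡.trans (≡.cong (ℚ._- seq y n) (x≡y n)) (ℚ.+-inverseʳ (seq y n))))
    Seq.null-0)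

ℝ-commutativeRing : CommutativeRing 0ℓ 0ℓ
ℝ-commutativeRing = record
  { Carrier = ℝ ; _≈_ = _≈ℝ_ ; _+_ = _+ℝ_ ; _*_ = _*ℝ_ ; -_ = -ℝ_
  ; 0# = fromℚ 0ℚ ; 1# = fromℚ 1ℚ
  ; isCommutativeRing = record
    { isRing = record
      { +-isAbelianGroup = record
        { isGroup = record
          { isMonoid = record
            { isSemigroup = record
              { isMagma = record
                { isEquivalence = record
                  { refl  = pointwise λ _ → ≡.refl
                  ; sym   = ≈-sym
                  ; trans = ≈-trans
                  }
                ; ∙-cong = +-cong
                }
              ; assoc = λ x y z → pointwise λ n → ℚ.+-assoc (seq x n) (seq y n) (seq z n)
              }
            ; identity = (λ x → pointwise λ n → ℚ.+-identityˡ (seq x n))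
                       , (λ x → pointwise λ n → ℚ.+-identityʳ (seq x n))
            }
          ; inverse = (λ x → pointwise λ n → ℚ.+-inverseˡ (seq x n))
                    , (λ x → pointwise λ n → ℚ.+-inverseʳ (seq x n))
          ; ⁻¹-cong = neg-cong
          }
        ; comm = λ x y → pointwise λ n → ℚ.+-comm (seq x n) (seq y n)
        }
      ; *-cong = *-cong
      ; *-assoc = λ x y z → pointwise λ n → ℚ.*-assoc (seq x n) (seq y n) (seq z n)
      ; *-identity = (λ x → pointwise λ n → ℚ.*-identityˡ (seq x n))
                   , (λ x → pointwise λ n → ℚ.*-identityʳ (seq x n))
      ; distrib = (λ x y z → pointwise λ n → ℚ.*-distribˡ-+ (seq x n) (seq y n) (seq z n))
                , (λ x y z → pointwise λ n → ℚ.*-distribʳ-+ (seq x n) (seq y n) (seq z n))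
      }
    ; *-comm = λ x y → pointwise λ n → ℚ.*-comm (seq x n) (seq y n)
    }
  }
  where
  ≈-sym : ∀ {x y} → x ≈ℝ y → y ≈ℝ x
  ≈-sym {x} {y} (null-difference p) = null-difference (Seq.null-resp
    (λ n → sub-swap (seq x n) (seq y n))
    (Seq.null-neg p))

  ≈-trans : ∀ {x y z} → x ≈ℝ y → y ≈ℝ z → x ≈ℝ z
  ≈-trans {x} {y} {z} (null-difference p) (null-difference q) = null-difference (Seq.null-resp
    (λ n → sub-trans (seq x n) (seq y n) (seq z n))
    (Seq.null-+ p q))

  +-cong : ∀ {x x′ y y′} → x ≈ℝ x′ → y ≈ℝ y′ → (x +ℝ y) ≈ℝ (x′ +ℝ y′)
  +-cong {x} {x′} {y} {y′} (null-difference p) (null-difference q) = null-difference (Seq.null-resp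
    (λ n → sub-+ (seq x n) (seq x′ n) (seq y n) (seq y′ n))
    (Seq.null-+ p q))

  *-cong : ∀ {x x′ y y′} → x ≈ℝ x′ → y ≈ℝ y′ → (x *ℝ y) ≈ℝ (x′ *ℝ y′)
  *-cong {x} {x′} {y} {y′} (null-difference p) (null-difference q) = null-difference (Seq.null-resp
    (λ n → sub-* (seq x n) (seq x′ n) (seq y n) (seq y′ n))
    (Seq.null-+ (Seq.null-* {s = seq x} (cauchy⇒bounded (seq x) (cauchy x)) q)
                (Seq.null-* {s = seq y′} (cauchy⇒bounded (seq y′) (cauchy y′)) p)))

  neg-cong : ∀ {x y} → x ≈ℝ y → (-ℝ x) ≈ℝ (-ℝ y)
  neg-cong {x} {y} (null-difference p) = null-difference (Seq.null-resp
    (λ n → sub-neg (seq x n) (seq y n)) (Seq.null-neg p))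

private module R = CommutativeRing ℝ-commutativeRing

infix 6 _+i_

record ℂ : Set where
  constructor _+i_
  field re im : ℝ

open ℂ

ℂ-commutativeRing : CommutativeRing 0ℓ 0ℓ
ℂ-commutativeRing = record
  { Carrier = ℂ
  ; _≈_ = _≈_
  ; _+_ = _+_
  ; _*_ = _*_
  ; -_ = λ z → (R.- re z) +i (R.- im z)
  ; 0# = R.0# +i R.0#
  ; 1# = 1ℂ
  ; isCommutativeRing = record
    { isRing = record
      { +-isAbelianGroup = record
        { isGroup = record
          { isMonoid = record
            { isSemigroup = record
              { isMagma = record
                { isEquivalence = record
                  { refl  = R.refl , R.refl
                  ; sym   = λ (p , q) → R.sym p , R.sym q
                  ; trans = ≈-trans
                  }
                ; ∙-cong = λ (p , q) (p′ , q′) → R.+-cong p p′ , R.+-cong q q′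
                }
              ; assoc = λ _ _ _ → R.+-assoc _ _ _ , R.+-assoc _ _ _
              }
            ; identity = (λ _ → R.+-identityˡ _ , R.+-identityˡ _)
                       , (λ _ → R.+-identityʳ _ , R.+-identityʳ _)
            }
          ; inverse = (λ _ → R.-‿inverseˡ _ , R.-‿inverseˡ _)
                    , (λ _ → R.-‿inverseʳ _ , R.-‿inverseʳ _)
          ; ⁻¹-cong = λ (p , q) → R.-‿cong p , R.-‿cong q
          }
        ; comm = λ _ _ → R.+-comm _ _ , R.+-comm _ _
        }
      ; *-cong = λ (p , q) (p′ , q′) →
          R.+-cong (R.*-cong p p′) (R.-‿cong (R.*-cong q q′))
        , R.+-cong (R.*-cong p q′) (R.*-cong q p′)
      ; *-assoc = *-assoc
      ; *-identity = *-identityˡ , λ z → ≈-trans (*-comm z _) (*-identityˡ z)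
      ; distrib = *-distribˡ , *-distribʳ
      }
    ; *-comm = *-comm
    }
  }
  where
  _≈_ : ℂ → ℂ → Set
  z ≈ w = re z R.≈ re w × im z R.≈ im w

  _+_ _*_ : ℂ → ℂ → ℂ
  z + w = (re z R.+ re w) +i (im z R.+ im w)
  z * w = (re z R.* re w R.- im z R.* im w) +i (re z R.* im w R.+ im z R.* re w)

  1ℂ : ℂ
  1ℂ = R.1# +i R.0#

  ≈-trans : ∀ {z w v} → z ≈ w → w ≈ v → z ≈ v
  ≈-trans (p , q) (p′ , q′) = R.trans p p′ , R.trans q q′

  *-comm : ∀ z w → (z * w) ≈ (w * z)
  *-comm z w =
      R.+-cong (R.*-comm _ _) (R.-‿cong (R.*-comm _ _))
    , R.trans (R.+-comm _ _) (R.+-cong (R.*-comm _ _) (R.*-comm _ _))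

  *-assoc : ∀ z w v → ((z * w) * v) ≈ (z * (w * v))
  *-assoc (a +i b) (c +i d) (e +i f) =
      (pointwise λ n → solve 6 (λ a b c d e f →
        (a :* c :- b :* d) :* e :- (a :* d :+ b :* c) :* f :=
        a :* (c :* e :- d :* f) :- b :* (c :* f :+ d :* e)) ≡.refl
        (seq a n) (seq b n) (seq c n) (seq d n) (seq e n) (seq f n))
    , (pointwise λ n → solve 6 (λ a b c d e f →
        (a :* c :- b :* d) :* f :+ (a :* d :+ b :* c) :* e :=
        a :* (c :* f :+ d :* e) :+ b :* (c :* e :- d :* f)) ≡.refl
        (seq a n) (seq b n) (seq c n) (seq d n) (seq e n) (seq f n))

  *-identityˡ : ∀ z → (1ℂ * z) ≈ z
  *-identityˡ (a +i b) =
      (pointwise λ n → solve 2 (λ a b → con 1ℚ :* a :- con 0ℚ :* b := a) ≡.refl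
        (seq a n) (seq b n))
    , (pointwise λ n → solve 2 (λ a b → con 1ℚ :* b :+ con 0ℚ :* a := b) ≡.refl
        (seq a n) (seq b n))

  *-distribˡ : ∀ z w v → (z * (w + v)) ≈ ((z * w) + (z * v))
  *-distribˡ (a +i b) (c +i d) (e +i f) =
      (pointwise λ n → solve 6 (λ a b c d e f →
        a :* (c :+ e) :- b :* (d :+ f) := (a :* c :- b :* d) :+ (a :* e :- b :* f)) ≡.refl
        (seq a n) (seq b n) (seq c n) (seq d n) (seq e n) (seq f n))
    , (pointwise λ n → solve 6 (λ a b c d e f →
        a :* (d :+ f) :+ b :* (c :+ e) := (a :* d :+ b :* c) :+ (a :* f :+ b :* e)) ≡.refl
        (seq a n) (seq b n) (seq c n) (seq d n) (seq e n) (seq f n))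

  *-distribʳ : ∀ z w v → ((w + v) * z) ≈ ((w * z) + (v * z))
  *-distribʳ z w v = ≈-trans (*-comm (w + v) z) (≈-trans (*-distribˡ z w v)
    (let (p , q) = *-comm z w ; (p′ , q′) = *-comm z v in R.+-cong p p′ , R.+-cong q q′))

module Polynomials {c ℓ : Level} (K : CommutativeRing c ℓ) where

  private module K = CommutativeRing K

  infix  8 -ᴾ_
  infixl 7 _*ᴾ_
  infixl 6 _+ᴾ_
  infix  4 _≈ᴾ_

  -- The polynomial ring K[x₁, x₂, …]: ring expressions modulo the congruence generated by the
  -- axioms of commutative K-algebras, giving the free commutative K-algebra on
  -- countably many generators.  `var n` is the variable xₙ₊₁.

  data Poly : Set c where
    con       : K.Carrier → Poly
    var       : ℕ → Poly
    _+ᴾ_ _*ᴾ_ : Poly → Poly → Poly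
    -ᴾ_       : Poly → Poly

  data _≈ᴾ_ : Poly → Poly → Set (c ⊔ ℓ) where
    refl        : ∀ {a} → a ≈ᴾ a
    sym         : ∀ {a b} → a ≈ᴾ b → b ≈ᴾ a
    trans       : ∀ {a b d} → a ≈ᴾ b → b ≈ᴾ d → a ≈ᴾ d
    +-cong      : ∀ {a a′ b b′} → a ≈ᴾ a′ → b ≈ᴾ b′ → a +ᴾ b ≈ᴾ a′ +ᴾ b′
    *-cong      : ∀ {a a′ b b′} → a ≈ᴾ a′ → b ≈ᴾ b′ → a *ᴾ b ≈ᴾ a′ *ᴾ b′
    neg-cong    : ∀ {a a′} → a ≈ᴾ a′ → -ᴾ a ≈ᴾ -ᴾ a′
    con-cong    : ∀ {k l} → k K.≈ l → con k ≈ᴾ con l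
    con-+       : ∀ k l → con (k K.+ l) ≈ᴾ con k +ᴾ con l
    con-*       : ∀ k l → con (k K.* l) ≈ᴾ con k *ᴾ con l
    +-assoc     : ∀ a b d → (a +ᴾ b) +ᴾ d ≈ᴾ a +ᴾ (b +ᴾ d)
    +-comm      : ∀ a b → a +ᴾ b ≈ᴾ b +ᴾ a
    +-identityˡ : ∀ a → con K.0# +ᴾ a ≈ᴾ a
    +-inverseˡ  : ∀ a → -ᴾ a +ᴾ a ≈ᴾ con K.0#
    *-assoc     : ∀ a b d → (a *ᴾ b) *ᴾ d ≈ᴾ a *ᴾ (b *ᴾ d)
    *-comm      : ∀ a b → a *ᴾ b ≈ᴾ b *ᴾ a
    *-identityˡ : ∀ a → con K.1# *ᴾ a ≈ᴾ a
    distribˡ    : ∀ a b d → a *ᴾ (b +ᴾ d) ≈ᴾ a *ᴾ b +ᴾ a *ᴾ d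

  polynomialRing : CommutativeRing c (c ⊔ ℓ)
  polynomialRing = record
    { Carrier = Poly ; _≈_ = _≈ᴾ_ ; _+_ = _+ᴾ_ ; _*_ = _*ᴾ_ ; -_ = -ᴾ_
    ; 0# = con K.0# ; 1# = con K.1#
    ; isCommutativeRing = record
      { isRing = record
        { +-isAbelianGroup = record
          { isGroup = record
            { isMonoid = record
              { isSemigroup = record
                { isMagma = record
                  { isEquivalence = record { refl = refl ; sym = sym ; trans = trans }
                  ; ∙-cong = +-cong
                  }
                ; assoc = +-assoc
                }
              ; identity = +-identityˡ , λ a → trans (+-comm _ _) (+-identityˡ a)
              }
            ; inverse = +-inverseˡ , λ a → trans (+-comm _ _) (+-inverseˡ a)
            ; ⁻¹-cong = neg-cong
            }
          ; comm = +-comm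
          }
        ; *-cong = *-cong
        ; *-assoc = *-assoc
        ; *-identity = *-identityˡ , λ a → trans (*-comm _ _) (*-identityˡ a)
        ; distrib = distribˡ , λ a b d → trans (*-comm _ _)
            (trans (distribˡ a b d) (+-cong (*-comm _ _) (*-comm _ _)))
        }
      ; *-comm = *-comm
      }
    }

  -- The homogeneous components: the least family of additive subgroups closed
  -- under graded multiplication, with K in degree 0 and xₖ in degree k.

  data Homogeneous : ℕ → Poly → Set (c ⊔ ℓ) where
    hom-con  : ∀ k → Homogeneous 0 (con k)
    hom-var  : ∀ n → Homogeneous (suc n) (var n)
    hom-*    : ∀ {d e a b} → Homogeneous d a → Homogeneous e b → Homogeneous (d ℕ.+ e) (a *ᴾ b)
    hom-0    : ∀ {d} → Homogeneous d (con K.0#)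
    hom-+    : ∀ {d a b} → Homogeneous d a → Homogeneous d b → Homogeneous d (a +ᴾ b)
    hom-neg  : ∀ {d a} → Homogeneous d a → Homogeneous d (-ᴾ a)
    hom-resp : ∀ {d a b} → a ≈ᴾ b → Homogeneous d a → Homogeneous d b

  -- `n` is an integer, and the sum of the components is {0} when n < 0.

  data Degree≤ (n : ℤ) : Poly → Set (c ⊔ ℓ) where
    deg-0    : Degree≤ n (con K.0#)
    deg-hom  : ∀ {d a} → + d ℤ.≤ n → Homogeneous d a → Degree≤ n a
    deg-+    : ∀ {a b} → Degree≤ n a → Degree≤ n b → Degree≤ n (a +ᴾ b)
    deg-resp : ∀ {a b} → a ≈ᴾ b → Degree≤ n a → Degree≤ n b

  module _ {i} {I : Set i} (v : I → Poly) where

    linearCombination : List (K.Carrier × I) → Poly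
    linearCombination = foldr (λ (k , x) a → con k *ᴾ v x +ᴾ a) (con K.0#)

    record IsLinearBasis : Set (c ⊔ ℓ ⊔ i) where
      field
        spanning    : ∀ a → ∃ λ ts → a ≈ᴾ linearCombination ts
        independent : ∀ ts → Unique (map proj₂ ts) → linearCombination ts ≈ᴾ con K.0# →
                      All (λ (k , _) → k K.≈ K.0#) ts

nth : List ℕ → ℕ → ℕ
nth []       _       = 0
nth (x ∷ _)  zero    = x
nth (_ ∷ xs) (suc k) = nth xs k

-- Zero parts are excluded, so each partition has exactly one representation.
record Partition : Set where
  field
    parts      : List ℕ
    decreasing : Linked ℕ._≥_ parts
    positive   : All (0 ℕ.<_) parts

  l : ℕ
  l = length parts

  -- `part i` is λᵢ for i ≥ 1, with λᵢ = 0 for i > l; `part 0` is a junk value.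
  part : ℕ → ℕ
  part i = nth parts (ℕ.pred i)

  -- For j ≥ 1, the j-th part of the conjugate: #{ i ∣ λᵢ ≥ j }.
  conjugatePart : ℕ → ℕ
  conjugatePart j = length (filter (j ℕ.≤?_) parts)

  -- The length of the main diagonal: #{ i ∣ λᵢ ≥ i }.
  diagonal : ℕ
  diagonal = length (filter (λ i → i ℕ.≤? part i) (applyUpTo suc l))

  α β : ℕ → ℤ
  α i = + part i ℤ.- + i
  β i = + conjugatePart i ℤ.- + i

open Partition using (l; part; diagonal; α; β) public

module Determinant {c ℓ} (R : CommutativeRing c ℓ) where

  open CommutativeRing R using (Carrier; _*_; -_; 1#; semiring)
  open Algebra.Properties.Semiring.Sum semiring using (sum)
  open Algebra.Properties.Semiring.Exp semiring using (_^_)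

  sgn : ℕ → Carrier
  sgn n = (- 1#) ^ n

  -- Laplace expansion along the first row.
  det : ∀ {n} → (Fin n → Fin n → Carrier) → Carrier
  det {zero}  A = 1#
  det {suc n} A = sum λ j → sgn (toℕ j) * (A zero j * det λ i k → A (suc i) (punchIn j k))

  -- det [ f i j ] with indices 1 ≤ i, j ≤ n.
  det[_] : ∀ n → (ℕ → ℕ → Carrier) → Carrier
  det[ n ] f = det {n} λ i j → f (suc (toℕ i)) (suc (toℕ j))

-- `h r k` is h⁽ʳ⁾ₖ.

module SymmetricFunctions {c ℓ} (R : CommutativeRing c ℓ)
  (h : ℤ → ℤ → CommutativeRing.Carrier R) where

  open CommutativeRing R using (Carrier; _*_; 0#; 1#; semiring)
  open Algebra.Properties.Semiring.Sum semiring using (sum)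
  open Determinant R

  schur : Partition → Carrier
  schur Λ = det[ l Λ ] λ i j → h (+ j ℤ.- + 1) (+ part Λ i ℤ.- + i ℤ.+ + 1)

  -- `elementary p a` is e⁽ᵖ⁾ₐ.
  elementary : ℤ → ℤ → Carrier
  elementary p a with p ℤ.- a
  ... | -[1+ _ ] = 0#
  ... | +0       = 1#
  ... | +[1+ d ] = det[ suc d ] λ i j → h (ℤ.- p ℤ.+ + j) (p ℤ.+ + 1 ℤ.- + i)

  -- `hook m n` is s₍ₘ∣ₙ₎; the sum over 0 ≤ p ≤ n is empty for n < 0.
  hook : ℤ → ℤ → Carrier
  hook m (+ n)    = sum {suc n} λ p →
    sgn (toℕ p) * (h (+ toℕ p) (m ℤ.+ + 1) * elementary (ℤ.- + toℕ p) (ℤ.- + n))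
  hook m -[1+ _ ] = 0#

open Polynomials ℂ-commutativeRing public
  using (Poly; var; _≈ᴾ_; polynomialRing; Degree≤; IsLinearBasis)

B : Set
B = Poly

private module 𝔹 = CommutativeRing polynomialRing

h⁰ : ℤ → B
h⁰ +[1+ n ] = var n
h⁰ +0       = 𝔹.1#
h⁰ -[1+ _ ] = 𝔹.0#

open Determinant polynomialRing public using (det[_])
open SymmetricFunctions polynomialRing public using (schur; hook)

record IsGeneralizedFamily (h : ℤ → ℤ → B) : Set where
  field
    extends : ∀ k → h (+ 0) k ≈ᴾ h⁰ k
    degree  : ∀ r k → Degree≤ (k ℤ.+ r) (h r k)
    unit    : ∀ k → h k (ℤ.- k) ≈ᴾ 𝔹.1#
    vanish  : ∀ r k → k ℤ.+ r ℤ.< + 0 → h r k ≈ᴾ 𝔹.0#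
    basis   : IsLinearBasis (schur h)

{-# OPTIONS --safe #-}
module Submission where

-- Put U_{s,r} = h⁽ʳ⁾₋ₛ, an upper unitriangular matrix.  Up to sign, e⁽⁻ᵖ⁾₋ₙ is the (p, n) entry of U⁻¹,
-- being a Hessenberg determinant in U.  Hence the column of hook functions with leg b is a combination
-- of the columns h⁽ᵖ⁾, p ≤ b, of the Jacobi–Trudi matrix, with coefficient (-1)ᵇ at p = b; these
-- signs cancel the sign of the reversal of the columns, which gives the first equality.  For the second,
-- s₍₋₁₋ₛ∣ₙ₎ = (-1)ˢ δₛₙ because U U⁻¹ = 1, so each row below the main diagonal of λ has a single nonzero
-- entry; expanding along the last such row, repeatedly, leaves the Frobenius coordinates.

open import Defs hiding (det[_]; schur; hook)
open import Algebra.Bundles using (CommutativeRing)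
import Algebra.Properties.Ring
import Algebra.Properties.Semiring.Sum
import Algebra.Solver.Ring.NaturalCoefficients.Default
open import Data.Fin.Base using (Fin; zero; suc; toℕ; punchIn)
open import Data.Integer using (ℤ; +_; _-_)
open import Data.Integer.Base as ℤ using (+0; +[1+_]; -[1+_]; _⊖_)
import Data.Integer.Properties as ℤ
import Data.Integer.Tactic.RingSolver as ℤ-Solver
open import Data.List.Base
  using (List; []; _∷_; _++_; _∷ʳ_; map; length; filter; tabulate; applyUpTo; applyDownFrom)
import Data.List.Properties as List
open import Data.List.Membership.Propositional using (_∈_)
open import Data.List.Membership.Propositional.Properties using (∈-applyUpTo⁺)
open import Data.List.Relation.Binary.Pointwise as Pointwise using (Pointwise; []; _∷_)
open import Data.List.Relation.Unary.All using (All; []; _∷_)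
import Data.List.Relation.Unary.All.Properties as All
open import Data.List.Relation.Unary.Any using (here; there)
open import Data.List.Relation.Unary.Linked using (Linked; []; [-]; _∷_)
open import Data.Nat using (ℕ; _≤_)
open import Data.Nat.Base as ℕ using (zero; suc; _∸_; z≤n; s≤s; z<s; s<s; _<_; _⊔_)
import Data.Nat.Properties as ℕ
open import Data.Product using (_×_; _,_; proj₁; proj₂)
open import Function.Base using (_∘_; id)
import Level
open import Relation.Binary.PropositionalEquality as ≡ using (_≡_)
import Relation.Binary.Reasoning.Setoid
open import Relation.Nullary using (¬_; yes; no; contradiction)
open import Relation.Unary using (Pred; Decidable)
open Partition using (parts; decreasing; conjugatePart)

-- Lists of values on initial segments of ℕ.

module _ {a ℓ} {A : Set a} {_∼_ : A → A → Set ℓ} where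

  Pointwise-applyUpTo⁺ : ∀ (f g : ℕ → A) n → (∀ {j} → j < n → f j ∼ g j) →
                         Pointwise _∼_ (applyUpTo f n) (applyUpTo g n)
  Pointwise-applyUpTo⁺ f g zero    f∼g = []
  Pointwise-applyUpTo⁺ f g (suc n) f∼g =
    f∼g z<s ∷ Pointwise-applyUpTo⁺ (f ∘ suc) (g ∘ suc) n (f∼g ∘ s<s)

tabulate-toℕ : ∀ {a} {A : Set a} (f : ℕ → A) n → tabulate {n = n} (f ∘ toℕ) ≡ applyUpTo f n
tabulate-toℕ f zero    = ≡.refl
tabulate-toℕ f (suc n) = ≡.cong (f 0 ∷_) (tabulate-toℕ (f ∘ suc) n)

applyUpTo-+ : ∀ {a} {A : Set a} (f : ℕ → A) m n →
              applyUpTo f (m ℕ.+ n) ≡ applyUpTo f m ++ applyUpTo (λ i → f (m ℕ.+ i)) n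
applyUpTo-+ f zero    n = ≡.refl
applyUpTo-+ f (suc m) n = ≡.cong (f 0 ∷_) (applyUpTo-+ (f ∘ suc) m n)

applyDownFrom≡applyUpTo : ∀ {a} {A : Set a} (f : ℕ → A) n →
                          applyDownFrom f n ≡ applyUpTo (λ j → f (n ∸ suc j)) n
applyDownFrom≡applyUpTo f zero    = ≡.refl
applyDownFrom≡applyUpTo f (suc n) = ≡.cong (f n ∷_) (applyDownFrom≡applyUpTo f n)

-- Alternating forms on lists of columns.

module Columns {c ℓ} (R : CommutativeRing c ℓ) where

  open CommutativeRing R hiding (zero)
  open Algebra.Properties.Ring ring
  open Algebra.Properties.Semiring.Sum semiring using (sum; sum-cong-≋; *-distribˡ-sum)
  open Relation.Binary.Reasoning.Setoid setoid
  open Determinant R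

  open Algebra.Solver.Ring.NaturalCoefficients.Default commutativeSemiring
    using (solve; _:=_; _:+_; _:*_; con)

  -- Subtraction is written as addition of a multiple of ε, an atom for the semiring solver.
  ε : Carrier
  ε = - 1#

  ε*ε≈1 : ε * ε ≈ 1#
  ε*ε≈1 = trans (-1*x≈-x ε) (-‿involutive 1#)

  x+εx≈0 : ∀ x → x + ε * x ≈ 0#
  x+εx≈0 x = trans (+-congˡ (-1*x≈-x x)) (-‿inverseʳ x)

  x+y≈0⇒x≈εy : ∀ {x y} → x + y ≈ 0# → x ≈ ε * y
  x+y≈0⇒x≈εy {x} {y} eq = trans (+-inverseˡ-unique x y eq) (sym (-1*x≈-x y))

  sgn-square : ∀ n → sgn n * sgn n ≈ 1#
  sgn-square zero    = *-identityˡ 1#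
  sgn-square (suc n) = begin
    (ε * sgn n) * (ε * sgn n)  ≈⟨ solve 2 (λ x y → (x :* y) :* (x :* y) := (x :* x) :* (y :* y)) refl ε (sgn n) ⟩
    (ε * ε) * (sgn n * sgn n)  ≈⟨ *-cong ε*ε≈1 (sgn-square n) ⟩
    1# * 1#                    ≈⟨ *-identityˡ 1# ⟩
    1#                         ∎

  sgn-cancel : ∀ n x → sgn n * (sgn n * x) ≈ x
  sgn-cancel n x = trans (sym (*-assoc _ _ _)) (trans (*-congʳ (sgn-square n)) (*-identityˡ x))

  -- Columns are infinite, so the same list serves determinants of every size; the form decides how
  -- many rows it reads.
  Column = ℕ → Carrier
  Form   = List Column → Carrier

  _≐_ : Column → Column → Set ℓ
  x ≐ y = ∀ i → x i ≈ y i

  _≋_ : List Column → List Column → Set (c Level.⊔ ℓ)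
  _≋_ = Pointwise _≐_

  ≋-refl : ∀ {xs} → xs ≋ xs
  ≋-refl = Pointwise.refl λ _ → refl

  _⊕[_]_ : Column → Carrier → Column → Column
  (x ⊕[ k ] y) i = x i + k * y i

  shift : Column → Column
  shift x = x ∘ suc

  -- `linear` combines additivity and homogeneity in one place. Only adjacent repetitions are
  -- required: `swap` brings distant equal columns together.
  record IsAlternating (F : Form) : Set (c Level.⊔ ℓ) where
    field
      respects : ∀ {xs ys} → xs ≋ ys → F xs ≈ F ys
      linear   : ∀ pre x k y post →
                 F (pre ++ (x ⊕[ k ] y) ∷ post) ≈ F (pre ++ x ∷ post) + k * F (pre ++ y ∷ post)
      repeated : ∀ pre x post → F (pre ++ x ∷ x ∷ post) ≈ 0#

  open IsAlternating

  -- This lets statements about the first columns be carried to any position by induction.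
  fix-first : ∀ {F} → IsAlternating F → ∀ x → IsAlternating (F ∘ (x ∷_))
  fix-first F-alt x .respects xs≋ys = F-alt .respects ((λ _ → refl) ∷ xs≋ys)
  fix-first F-alt x .linear   pre   = F-alt .linear (x ∷ pre)
  fix-first F-alt x .repeated pre   = F-alt .repeated (x ∷ pre)

  fix-prefix : ∀ {F} xs → IsAlternating F → IsAlternating (F ∘ (xs ++_))
  fix-prefix []       F-alt = F-alt
  fix-prefix (x ∷ xs) F-alt = fix-prefix xs (fix-first F-alt x)

  -- This is f 0 - f 1 + f 2 - ⋯ with n terms, in Horner form, so that inductions from the front
  -- meet no powers of the sign.
  alt : ℕ → (ℕ → Carrier) → Carrier
  alt zero    f = 0#
  alt (suc n) f = f 0 + ε * alt n (f ∘ suc)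

  alt-cong : ∀ n {f g} → (∀ {i} → i < n → f i ≈ g i) → alt n f ≈ alt n g
  alt-cong zero    f≈g = refl
  alt-cong (suc n) f≈g = +-cong (f≈g z<s) (*-congˡ (alt-cong n (f≈g ∘ s<s)))

  0+ε0≈0 : 0# + ε * 0# ≈ 0#
  0+ε0≈0 = solve 1 (λ e → con 0 :+ e :* con 0 := con 0) refl ε

  alt-zero : ∀ n {f} → (∀ {i} → i < n → f i ≈ 0#) → alt n f ≈ 0#
  alt-zero zero    f≈0 = refl
  alt-zero (suc n) f≈0 = trans (+-cong (f≈0 z<s) (*-congˡ (alt-zero n (f≈0 ∘ s<s)))) 0+ε0≈0

  alt-last : ∀ n f → alt (suc n) f ≈ alt n f + sgn n * f n
  alt-last zero    f = solve 2 (λ e x → x :+ e :* con 0 := con 0 :+ con 1 :* x) refl ε (f 0)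
  alt-last (suc n) f = begin
    f 0 + ε * alt (suc n) (f ∘ suc)                        ≈⟨ +-congˡ (*-congˡ (alt-last n (f ∘ suc))) ⟩
    f 0 + ε * (alt n (f ∘ suc) + sgn n * f (suc n))        ≈⟨ solve 5 (λ x e a s y → x :+ e :* (a :+ s :* y) := (x :+ e :* a) :+ (e :* s) :* y) refl (f 0) ε _ (sgn n) (f (suc n)) ⟩
    (f 0 + ε * alt n (f ∘ suc)) + (ε * sgn n) * f (suc n)  ∎

  alt-skip : ∀ m n f → (∀ {i} → i < m → f i ≈ 0#) → alt (m ℕ.+ n) f ≈ sgn m * alt n (λ i → f (m ℕ.+ i))
  alt-skip zero    n f f≈0 = sym (*-identityˡ _)
  alt-skip (suc m) n f f≈0 = begin
    f 0 + ε * alt (m ℕ.+ n) (f ∘ suc)            ≈⟨ +-cong (f≈0 z<s) (*-congˡ (alt-skip m n (f ∘ suc) (f≈0 ∘ s<s))) ⟩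
    0# + ε * (sgn m * alt n _)                   ≈⟨ solve 3 (λ e s a → con 0 :+ e :* (s :* a) := (e :* s) :* a) refl ε (sgn m) _ ⟩
    (ε * sgn m) * alt n (λ i → f (suc m ℕ.+ i))  ∎

  sum≈alt : ∀ n f → sum {n} (λ p → sgn (toℕ p) * f (toℕ p)) ≈ alt n f
  sum≈alt zero    f = refl
  sum≈alt (suc n) f = +-cong (*-identityˡ _) (begin
    sum {n} (λ p → (ε * sgn (toℕ p)) * f (suc (toℕ p)))  ≈⟨ sum-cong-≋ {n} (λ p → *-assoc _ _ _) ⟩
    sum {n} (λ p → ε * (sgn (toℕ p) * f (suc (toℕ p))))  ≈⟨ *-distribˡ-sum {n} ε _ ⟨
    ε * sum {n} (λ p → sgn (toℕ p) * f (suc (toℕ p)))    ≈⟨ *-congˡ (sum≈alt n (f ∘ suc)) ⟩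
    ε * alt n (f ∘ suc)                                  ∎)

  -- Column operations.

  module _ {F : Form} (F-alt : IsAlternating F) where

    zero-column : ∀ x xs → (∀ i → x i ≈ 0#) → F (x ∷ xs) ≈ 0#
    -- A zero column is its own double, so additivity makes the value of the form equal to its
    -- double.
    zero-column x xs x≈0 = x+x≈x⇒x≈0 _ (begin
      F (x ∷ xs) + F (x ∷ xs)       ≈⟨ +-congˡ (*-identityˡ _) ⟨
      F (x ∷ xs) + 1# * F (x ∷ xs)  ≈⟨ F-alt .linear [] x 1# x xs ⟨
      F ((x ⊕[ 1# ] x) ∷ xs)        ≈⟨ F-alt .respects (x+x≈x ∷ ≋-refl) ⟩
      F (x ∷ xs)                    ∎)
      where
      x+x≈x : (x ⊕[ 1# ] x) ≐ x
      x+x≈x i = trans (+-congˡ (trans (*-identityˡ _) (x≈0 i))) (+-identityʳ _)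

    scale-column : ∀ k x xs → F ((λ i → k * x i) ∷ xs) ≈ k * F (x ∷ xs)
    scale-column k x xs = begin
      F ((λ i → k * x i) ∷ xs)              ≈⟨ F-alt .respects ((λ i → sym (+-identityˡ _)) ∷ ≋-refl) ⟩
      F (((λ _ → 0#) ⊕[ k ] x) ∷ xs)        ≈⟨ F-alt .linear [] _ k x xs ⟩
      F ((λ _ → 0#) ∷ xs) + k * F (x ∷ xs)  ≈⟨ +-congʳ (zero-column _ xs (λ _ → refl)) ⟩
      0# + k * F (x ∷ xs)                   ≈⟨ +-identityˡ _ ⟩
      k * F (x ∷ xs)                        ∎

    -- Polarization: the form vanishes with x + y in both places, and multilinearity splits that
    -- value into four terms, two of which vanish.
    swap : ∀ x y xs → F (x ∷ y ∷ xs) ≈ ε * F (y ∷ x ∷ xs)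
    swap x y xs = x+y≈0⇒x≈εy (begin
      F (x ∷ y ∷ xs) + F (y ∷ x ∷ xs)
        ≈⟨ solve 2 (λ p q → p :+ q := (con 0 :+ con 1 :* p) :+ con 1 :* (q :+ con 1 :* con 0)) refl _ _ ⟩
      (0# + 1# * F (x ∷ y ∷ xs)) + 1# * (F (y ∷ x ∷ xs) + 1# * 0#)
        ≈⟨ +-cong (+-congʳ (F-alt .repeated [] x xs)) (*-congˡ (+-congˡ (*-congˡ (F-alt .repeated [] y xs)))) ⟨
      (F (x ∷ x ∷ xs) + 1# * F (x ∷ y ∷ xs)) + 1# * (F (y ∷ x ∷ xs) + 1# * F (y ∷ y ∷ xs))
        ≈⟨ +-cong (F-alt .linear (x ∷ []) x 1# y xs) (*-congˡ (F-alt .linear (y ∷ []) x 1# y xs)) ⟨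
      F (x ∷ (x ⊕[ 1# ] y) ∷ xs) + 1# * F (y ∷ (x ⊕[ 1# ] y) ∷ xs)
        ≈⟨ F-alt .linear [] x 1# y _ ⟨
      F ((x ⊕[ 1# ] y) ∷ (x ⊕[ 1# ] y) ∷ xs)
        ≈⟨ F-alt .repeated [] _ xs ⟩
      0# ∎)

  move : ∀ {F} → IsAlternating F → ∀ x ys zs →
         F (x ∷ ys ++ zs) ≈ sgn (length ys) * F (ys ++ x ∷ zs)
  move F-alt x []       zs = sym (*-identityˡ _)
  move {F} F-alt x (y ∷ ys) zs = begin
    F (x ∷ y ∷ ys ++ zs)                           ≈⟨ swap F-alt x y _ ⟩
    ε * F (y ∷ x ∷ ys ++ zs)                       ≈⟨ *-congˡ (move (fix-first F-alt y) x ys zs) ⟩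
    ε * (sgn (length ys) * F (y ∷ ys ++ x ∷ zs))   ≈⟨ *-assoc _ _ _ ⟨
    (ε * sgn (length ys)) * F (y ∷ ys ++ x ∷ zs)   ∎

  member-column : ∀ {F} → IsAlternating F → ∀ {x xs} → x ∈ xs → F (x ∷ xs) ≈ 0#
  member-column F-alt {xs = _ ∷ xs} (here ≡.refl) = F-alt .repeated [] _ xs
  member-column {F} F-alt {x} {y ∷ xs} (there x∈xs) = begin
    F (x ∷ y ∷ xs)      ≈⟨ swap F-alt x y xs ⟩
    ε * F (y ∷ x ∷ xs)  ≈⟨ *-congˡ (member-column (fix-first F-alt y) x∈xs) ⟩
    ε * 0#              ≈⟨ zeroʳ ε ⟩
    0#                  ∎

  -- The alternating sum is a combination of columns that occur again in xs; its terms are split off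
  -- from the last one, each leaving a repeated column.
  absorb : ∀ {F} → IsAlternating F → ∀ n x (a : ℕ → Column) (k : ℕ → Carrier) xs → (∀ {p} → p < n → a p ∈ xs) →
           F ((λ i → alt n (λ p → a p i * k p) + x i) ∷ xs) ≈ F (x ∷ xs)
  absorb F-alt zero x a k xs a∈xs = F-alt .respects ((λ i → +-identityˡ _) ∷ ≋-refl)
  absorb {F} F-alt (suc n) x a k xs a∈xs = begin
    F ((λ i → alt (suc n) (λ p → a p i * k p) + x i) ∷ xs)
      ≈⟨ F-alt .respects ((λ i → trans (+-congʳ (alt-last n _)) 
           (solve 5 (λ A s y l z → (A :+ s :* (y :* l)) :+ z := (A :+ z) :+ (s :* l) :* y)
             refl _ (sgn n) (a n i) (k n) (x i))) ∷ ≋-refl) ⟩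
    F (((λ i → alt n (λ p → a p i * k p) + x i) ⊕[ sgn n * k n ] a n) ∷ xs)
      ≈⟨ F-alt .linear [] _ _ _ xs ⟩
    F ((λ i → alt n (λ p → a p i * k p) + x i) ∷ xs) + (sgn n * k n) * F (a n ∷ xs)
      ≈⟨ +-cong (absorb F-alt n x a k xs (a∈xs ∘ ℕ.m≤n⇒m≤1+n)) (*-congˡ (member-column F-alt (a∈xs ℕ.≤-refl))) ⟩
    F (x ∷ xs) + (sgn n * k n) * 0#
      ≈⟨ trans (+-congˡ (zeroʳ _)) (+-identityʳ _) ⟩
    F (x ∷ xs) ∎

  -- The reversal sign cancels against the signs of the leading coefficients.
  triangular-reversal : ∀ {F} → IsAlternating F → ∀ (a b : ℕ → Column) (k : ℕ → ℕ → Carrier) n →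
    (∀ q → k q q ≈ 1#) → (∀ q i → b q i ≈ alt (suc q) (λ p → a p i * k p q)) →
    F (applyDownFrom b n) ≈ F (applyUpTo a n)
  triangular-reversal F-alt a b k zero    k≈1 b≈alt = refl
  triangular-reversal {F} F-alt a b k (suc n) k≈1 b≈alt = begin
    F (b n ∷ applyDownFrom b n)
      -- With `b n` held in front, induction turns the other columns into the a p with p < n. These
      -- absorb every term of `b n` except the leading one.
      ≈⟨ triangular-reversal (fix-first F-alt (b n)) a b k n k≈1 b≈alt ⟩
    F (b n ∷ applyUpTo a n)
      ≈⟨ F-alt .respects ((λ i → trans (b≈alt n i) (trans (alt-last n _) (+-congˡ (*-congˡ (trans (*-congˡ (k≈1 n)) (*-identityʳ _)))))) ∷ ≋-refl) ⟩
    F ((λ i → alt n (λ p → a p i * k p n) + sgn n * a n i) ∷ applyUpTo a n)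
      ≈⟨ absorb F-alt n _ a (λ p → k p n) _ (∈-applyUpTo⁺ a) ⟩
    F ((λ i → sgn n * a n i) ∷ applyUpTo a n)
      ≈⟨ scale-column F-alt (sgn n) (a n) _ ⟩
    sgn n * F (a n ∷ applyUpTo a n)
      ≡⟨ ≡.cong (λ xs → sgn n * F (a n ∷ xs)) (List.++-identityʳ _) ⟨
    sgn n * F (a n ∷ applyUpTo a n ++ [])
      ≈⟨ *-congˡ (move F-alt (a n) (applyUpTo a n) []) ⟩
    sgn n * (sgn (length (applyUpTo a n)) * F (applyUpTo a n ∷ʳ a n))
      ≡⟨ ≡.cong₂ (λ m xs → sgn n * (sgn m * F xs)) (List.length-applyUpTo a n) (List.applyUpTo-∷ʳ a n) ⟩
    sgn n * (sgn n * F (applyUpTo a (suc n)))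
      ≈⟨ sgn-cancel n _ ⟩
    F (applyUpTo a (suc n)) ∎

  -- Laplace expansion and the determinant as a form.

  -- Expansion along row 0. A column that is passed over joins the form without its top entry, so
  -- minors need no deletion index.
  expand : Form → Form
  expand F []       = 0#
  expand F (x ∷ xs) = x 0 * F (map shift xs) + ε * expand (λ ys → F (shift x ∷ ys)) xs

  -- Linearity in the form itself is needed because a modified column becomes part of the form once
  -- it has been passed over.
  expand-linear : ∀ {F G H} k → (∀ ys → H ys ≈ F ys + k * G ys) →
                  ∀ xs → expand H xs ≈ expand F xs + k * expand G xs
  expand-linear k H≈F+kG [] = solve 1 (λ k → con 0 := con 0 :+ k :* con 0) refl k
  expand-linear k H≈F+kG (x ∷ xs) = trans
    (+-cong (*-congˡ (H≈F+kG _)) (*-congˡ (expand-linear k (λ ys → H≈F+kG (shift x ∷ ys)) xs)))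
    (solve 7 (λ x e k f g f′ g′ → x :* (f :+ k :* g) :+ e :* (f′ :+ k :* g′) :=
                                  (x :* f :+ e :* f′) :+ k :* (x :* g :+ e :* g′))
      refl (x 0) ε k _ _ _ _)

  shift-≋ : ∀ {xs ys} → xs ≋ ys → map shift xs ≋ map shift ys
  shift-≋ []             = []
  shift-≋ (x≐y ∷ xs≋ys) = (x≐y ∘ suc) ∷ shift-≋ xs≋ys

  expand-cong : ∀ {F G} → (∀ {xs ys} → xs ≋ ys → F xs ≈ G ys) →
                ∀ {xs ys} → xs ≋ ys → expand F xs ≈ expand G ys
  expand-cong F≈G []             = refl
  expand-cong F≈G (x≐y ∷ xs≋ys) =
    +-cong (*-cong (x≐y 0) (F≈G (shift-≋ xs≋ys)))
           (*-congˡ (expand-cong (λ ps → F≈G ((x≐y ∘ suc) ∷ ps)) xs≋ys))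

  expand-zero : ∀ {F} → (∀ ys → F ys ≈ 0#) → ∀ xs → expand F xs ≈ 0#
  expand-zero F≈0 []       = refl
  expand-zero F≈0 (x ∷ xs) = trans
    (+-cong (trans (*-congˡ (F≈0 _)) (zeroʳ _)) (*-congˡ (expand-zero (λ ys → F≈0 (shift x ∷ ys)) xs))) 0+ε0≈0

  x0+ε0≈0 : ∀ x → x * 0# + ε * 0# ≈ 0#
  x0+ε0≈0 x = solve 2 (λ x e → x :* con 0 :+ e :* con 0 := con 0) refl x ε

  expand-alternating : ∀ {F} → IsAlternating F → IsAlternating (expand F)
  expand-alternating F-alt .respects = expand-cong (F-alt .respects)
  expand-alternating {F} F-alt .linear = go F-alt
    where
    go : ∀ {F} → IsAlternating F → ∀ pre x k y post →
         expand F (pre ++ (x ⊕[ k ] y) ∷ post) ≈ expand F (pre ++ x ∷ post) + k * expand F (pre ++ y ∷ post)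
    go F-alt [] x k y post = trans
      (+-congˡ (*-congˡ (expand-linear k (λ ys → F-alt .linear [] (shift x) k (shift y) ys) post)))
      (solve 7 (λ x k y f e f′ g′ → (x :+ k :* y) :* f :+ e :* (f′ :+ k :* g′) :=
                                    (x :* f :+ e :* f′) :+ k :* (y :* f :+ e :* g′))
        refl (x 0) k (y 0) _ ε _ _)
    go {F} F-alt (p ∷ pre) x k y post
      rewrite List.map-++ shift pre ((x ⊕[ k ] y) ∷ post)
            | List.map-++ shift pre (x ∷ post)
            | List.map-++ shift pre (y ∷ post) = trans
      (+-cong (*-congˡ (F-alt .linear (map shift pre) (shift x) k (shift y) (map shift post)))
              (*-congˡ (go (fix-first F-alt (shift p)) pre x k y post)))
      (solve 7 (λ x e k f g f′ g′ → x :* (f :+ k :* g) :+ e :* (f′ :+ k :* g′) :=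
                                    (x :* f :+ e :* f′) :+ k :* (x :* g :+ e :* g′))
        refl (p 0) ε k _ _ _ _)
  expand-alternating {F} F-alt .repeated = go F-alt
    where
    go : ∀ {F} → IsAlternating F → ∀ pre x post → expand F (pre ++ x ∷ x ∷ post) ≈ 0#
    go {F} F-alt [] x post = begin
      x 0 * F (shift x ∷ map shift post) + ε * (x 0 * F (shift x ∷ map shift post) + ε * expand _ post)
        -- Terms that use neither copy of x in the top row keep both copies in the minor and vanish;
        -- the two that use one copy have equal minors and opposite signs.
        ≈⟨ +-congˡ (*-congˡ (trans (+-congˡ (trans (*-congˡ (expand-zero (F-alt .repeated [] (shift x)) post)) (zeroʳ ε))) (+-identityʳ _))) ⟩
      x 0 * F (shift x ∷ map shift post) + ε * (x 0 * F (shift x ∷ map shift post))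
        ≈⟨ x+εx≈0 _ ⟩
      0# ∎
    go F-alt (p ∷ pre) x post rewrite List.map-++ shift pre (x ∷ x ∷ post) = trans
      (+-cong (*-congˡ (F-alt .repeated (map shift pre) (shift x) (map shift post)))
              (*-congˡ (go (fix-first F-alt (shift p)) pre x post)))
      (x0+ε0≈0 (p 0))

  -- D n xs is the determinant of the first n rows of the columns xs, and 0 unless length xs ≡ n.
  D : ℕ → Form
  D zero    []      = 1#
  D zero    (_ ∷ _) = 0#
  D (suc n) xs      = expand (D n) xs

  D-alternating : ∀ n → IsAlternating (D n)
  D-alternating zero .respects []      = refl
  D-alternating zero .respects (_ ∷ _) = refl
  D-alternating zero .linear [] x k y post =
    solve 1 (λ k → con 0 := con 0 :+ k :* con 0) refl k
  D-alternating zero .linear (_ ∷ _) x k y post =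
    solve 1 (λ k → con 0 := con 0 :+ k :* con 0) refl k
  D-alternating zero .repeated []      x post = refl
  D-alternating zero .repeated (_ ∷ _) x post = refl
  D-alternating (suc n) = expand-alternating (D-alternating n)

  -- Determinants whose last row is sparse.

  RowVanishes : ℕ → Column → Set ℓ
  RowVanishes n x = x n ≈ 0#

  map-shift⁺ : ∀ {n xs} → All (RowVanishes (suc n)) xs → All (RowVanishes n) (map shift xs)
  map-shift⁺ []       = []
  map-shift⁺ (p ∷ ps) = p ∷ map-shift⁺ ps

  expand-zero-row : ∀ {F n} → (∀ ys → All (RowVanishes n) ys → F ys ≈ 0#) →
                    ∀ xs → All (RowVanishes (suc n)) xs → expand F xs ≈ 0#
  expand-zero-row F≈0 []       []       = refl
  expand-zero-row F≈0 (x ∷ xs) (p ∷ ps) = trans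
    (+-cong (*-congˡ (F≈0 _ (map-shift⁺ ps)))
            (*-congˡ (expand-zero-row (λ ys qs → F≈0 (shift x ∷ ys) (p ∷ qs)) xs ps)))
    (x0+ε0≈0 (x 0))

  expand-zero-first-row : ∀ F xs → All (RowVanishes 0) xs → expand F xs ≈ 0#
  expand-zero-first-row F []       []       = refl
  expand-zero-first-row F (x ∷ xs) (p ∷ ps) = trans
    (+-cong (trans (*-congʳ p) (zeroˡ _)) (*-congˡ (expand-zero-first-row _ xs ps))) 0+ε0≈0

  D-zero-row : ∀ n xs → All (RowVanishes n) xs → D (suc n) xs ≈ 0#
  D-zero-row zero    = expand-zero-first-row (D zero)
  D-zero-row (suc n) = expand-zero-row (D-zero-row n)

  -- The inductive step of `D-last-row`, for general forms because `expand` changes the form as it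
  -- recurses. The first hypothesis removes the term that takes x in the top row.
  expand-last-row : ∀ {F G n k x} →
    (∀ ys → All (RowVanishes n) ys → G ys ≈ 0#) →
    (∀ ys → All (RowVanishes n) ys → G (ys ∷ʳ shift x) ≈ k * F ys) →
    ∀ xs → All (RowVanishes (suc n)) xs → expand G (xs ∷ʳ x) ≈ k * expand F xs
  expand-last-row {k = k} {x} G≈0 G≈kF [] [] = begin
    x 0 * _ + ε * 0#   ≈⟨ +-congʳ (*-congˡ (G≈0 [] [])) ⟩
    x 0 * 0# + ε * 0#  ≈⟨ x0+ε0≈0 (x 0) ⟩
    0#                 ≈⟨ zeroʳ k ⟨
    k * 0#             ∎
  expand-last-row {F} {k = k} {x} G≈0 G≈kF (y ∷ ys) (p ∷ ps)
    rewrite List.map-++ shift ys (x ∷ []) = trans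
    (+-cong (*-congˡ (G≈kF _ (map-shift⁺ ps)))
            (*-congˡ (expand-last-row {F ∘ (shift y ∷_)}
              (λ zs qs → G≈0 (shift y ∷ zs) (p ∷ qs)) (λ zs qs → G≈kF (shift y ∷ zs) (p ∷ qs)) ys ps)))
    (solve 5 (λ y k f e f′ → y :* (k :* f) :+ e :* (k :* f′) := k :* (y :* f :+ e :* f′))
      refl (y 0) k _ ε _)

  D-last-row : ∀ n xs x → All (RowVanishes n) xs → D (suc n) (xs ∷ʳ x) ≈ x n * D n xs
  D-last-row zero [] x [] = solve 2 (λ x e → x :* con 1 :+ e :* con 0 := x :* con 1) refl (x 0) ε
  -- The list is too long for one row, so both sides are 0.
  D-last-row zero (y ∷ ys) x (p ∷ ps) = begin
    y 0 * _ + ε * expand _ (ys ∷ʳ x)  ≈⟨ +-cong (trans (*-congʳ p) (zeroˡ _)) (*-congˡ (expand-zero {D 0 ∘ (shift y ∷_)} (λ _ → refl) (ys ∷ʳ x))) ⟩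
    0# + ε * 0#                       ≈⟨ 0+ε0≈0 ⟩
    0#                                ≈⟨ zeroʳ _ ⟨
    x 0 * 0#                          ∎
  D-last-row (suc n) xs x ps = expand-last-row {D n}
    (D-zero-row n) (λ ys → D-last-row n ys (shift x)) xs ps

  -- Moving x past zs to the end gives the sign and reduces to `D-last-row`.
  D-row : ∀ n ys x zs → All (RowVanishes n) ys → All (RowVanishes n) zs →
          D (suc n) (ys ++ x ∷ zs) ≈ sgn (length zs) * (x n * D n (ys ++ zs))
  D-row n ys x zs ps qs = begin
    D (suc n) (ys ++ x ∷ zs)
      ≡⟨ ≡.cong (λ ws → D (suc n) (ys ++ x ∷ ws)) (List.++-identityʳ zs) ⟨
    D (suc n) (ys ++ x ∷ zs ++ [])
      ≈⟨ move (fix-prefix ys (D-alternating (suc n))) x zs [] ⟩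
    sgn (length zs) * D (suc n) (ys ++ zs ∷ʳ x)
      ≡⟨ ≡.cong (λ ws → sgn (length zs) * D (suc n) ws) (List.++-assoc ys zs (x ∷ [])) ⟨
    sgn (length zs) * D (suc n) ((ys ++ zs) ∷ʳ x)
      ≈⟨ *-congˡ (D-last-row n (ys ++ zs) x (All.++⁺ ps qs)) ⟩
    sgn (length zs) * (x n * D n (ys ++ zs)) ∎

  -- For j > 0, `punchIn j` keeps the first column first; that column joins the form, and the
  -- remaining sum is again an expansion.
  expand-tabulate : ∀ F n (xs : Fin (suc n) → Column) →
    sum {suc n} (λ j → sgn (toℕ j) * (xs j 0 * F (tabulate λ k → shift (xs (punchIn j k)))))
    ≈ expand F (tabulate xs)
  expand-tabulate F n xs = +-cong
    (trans (*-identityˡ _) (*-congˡ (reflexive (≡.cong F (≡.sym (List.map-tabulate (xs ∘ suc) shift))))))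
    (rest n xs)
    where
    rest : ∀ n (xs : Fin (suc n) → Column) →
      sum {n} (λ j → sgn (suc (toℕ j)) * (xs (suc j) 0 * F (tabulate λ k → shift (xs (punchIn (suc j) k)))))
      ≈ ε * expand (F ∘ (shift (xs zero) ∷_)) (tabulate (xs ∘ suc))
    rest zero    xs = sym (zeroʳ ε)
    rest (suc n) xs = begin
      sum {suc n} (λ j → (ε * sgn (toℕ j)) * term j)
        ≈⟨ sum-cong-≋ {suc n} (λ j → *-assoc ε (sgn (toℕ j)) (term j)) ⟩
      sum {suc n} (λ j → ε * (sgn (toℕ j) * term j))
        ≈⟨ *-distribˡ-sum {suc n} ε (λ j → sgn (toℕ j) * term j) ⟨
      ε * sum {suc n} (λ j → sgn (toℕ j) * term j)
        ≈⟨ *-congˡ (expand-tabulate (F ∘ (shift (xs zero) ∷_)) n (xs ∘ suc)) ⟩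
      ε * expand (F ∘ (shift (xs zero) ∷_)) (tabulate (xs ∘ suc)) ∎
      where
      term : Fin (suc n) → Carrier
      term j = xs (suc j) 0 * F (shift (xs zero) ∷ tabulate λ k → shift (xs (suc (punchIn j k))))

  det≈D : ∀ n (xs : Fin n → Column) → det (λ i j → xs j (toℕ i)) ≈ D n (tabulate xs)
  det≈D zero    xs = refl
  det≈D (suc n) xs = begin
    det (λ i j → xs j (toℕ i))
      ≈⟨ sum-cong-≋ {suc n} (λ j → *-congˡ {sgn (toℕ j)} (*-congˡ {xs j 0} (det≈D n λ k → shift (xs (punchIn j k))))) ⟩
    sum {suc n} (λ j → sgn (toℕ j) * (xs j 0 * D n (tabulate λ k → shift (xs (punchIn j k)))))
      ≈⟨ expand-tabulate (D n) n xs ⟩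
    D (suc n) (tabulate xs) ∎

  det[]≈D : ∀ n f → det[ n ] f ≈ D n (applyUpTo (λ j i → f (suc i) (suc j)) n)
  det[]≈D n f = trans (det≈D n (λ j i → f (suc i) (suc (toℕ j))))
    (reflexive (≡.cong (D n) (tabulate-toℕ (λ j i → f (suc i) (suc j)) n)))

  -- Every minor that keeps the first column contains a zero column.
  D-unit-column : ∀ n x xs → x 0 ≈ 1# → (∀ i → x (suc i) ≈ 0#) → D (suc n) (x ∷ xs) ≈ D n (map shift xs)
  D-unit-column n x xs x0≈1 x≈0 = begin
    x 0 * D n (map shift xs) + ε * expand (D n ∘ (shift x ∷_)) xs
      ≈⟨ +-cong (trans (*-congʳ x0≈1) (*-identityˡ _)) (*-congˡ (expand-zero (λ ys → zero-column (D-alternating n) (shift x) ys x≈0) xs)) ⟩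
    D n (map shift xs) + ε * 0#
      ≈⟨ trans (+-congˡ (zeroʳ ε)) (+-identityʳ _) ⟩
    D n (map shift xs) ∎

-- Counting the values that satisfy a decreasing predicate.

module _ {p} {P : Pred ℕ p} (P? : Decidable P) where

  count : (ℕ → ℕ) → ℕ → ℕ
  count f n = length (filter P? (applyUpTo f n))

  -- Such a predicate holds exactly on an initial segment, so the count is a threshold. Conjugate
  -- parts and the diagonal length, defined as counts, become usable as bounds this way.
  count-decreasing : ∀ f n → (∀ i → P (f (suc i)) → P (f i)) →
                     (∀ {i} → i < count f n → P (f i)) ×
                     (∀ {i} → count f n ≤ i → i < n → ¬ P (f i))
  count-decreasing f zero dec = (λ ()) , λ _ ()
  count-decreasing f (suc n) dec with P? (f 0)
  ... | yes p = below , above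
    where
    ih = count-decreasing (f ∘ suc) n (dec ∘ suc)

    below : ∀ {i} → i < suc (count (f ∘ suc) n) → P (f i)
    below {zero}  _         = p
    below {suc i} (s<s i<c) = proj₁ ih i<c

    above : ∀ {i} → suc (count (f ∘ suc) n) ≤ i → i < suc n → ¬ P (f i)
    above {suc i} (s≤s c≤i) (s<s i<n) = proj₂ ih c≤i i<n
  ... | no ¬p = (λ i<c → contradiction (≡.subst (_ <_) none i<c) ℕ.n≮0) , λ _ _ → never _
    where
    never : ∀ i → ¬ P (f i)
    never zero    = ¬p
    never (suc i) = never i ∘ dec i

    none : count (f ∘ suc) n ≡ 0
    none = ≡.cong length (List.filter-none P? (All.applyUpTo⁺₂ (f ∘ suc) n (never ∘ suc)))

-- Rows, columns and the main diagonal of a partition.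

nth-antitone : ∀ {xs} → Linked ℕ._≥_ xs → ∀ i → nth xs (suc i) ≤ nth xs i
nth-antitone []           i       = z≤n
nth-antitone [-]          i       = z≤n
nth-antitone (x≥y ∷ _)    zero    = x≥y
nth-antitone (_ ∷ sorted) (suc i) = nth-antitone sorted i

nth-beyond : ∀ xs {i} → length xs ≤ i → nth xs i ≡ 0
nth-beyond []       _         = ≡.refl
nth-beyond (x ∷ xs) (s≤s n≤i) = nth-beyond xs n≤i

applyUpTo-nth : ∀ xs → applyUpTo (nth xs) (length xs) ≡ xs
applyUpTo-nth []       = ≡.refl
applyUpTo-nth (x ∷ xs) = ≡.cong (x ∷_) (applyUpTo-nth xs)

module _ (Λ : Partition) where

  part-beyond : ∀ {i} → l Λ ≤ i → part Λ (suc i) ≡ 0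
  part-beyond = nth-beyond (parts Λ)

  conjugatePart≤l : ∀ j → conjugatePart Λ j ≤ l Λ
  conjugatePart≤l j = List.length-filter (j ℕ.≤?_) (parts Λ)

  private
    conjugatePart≡count : ∀ j → count (j ℕ.≤?_) (nth (parts Λ)) (l Λ) ≡ conjugatePart Λ j
    conjugatePart≡count j = ≡.cong (length ∘ filter (j ℕ.≤?_)) (applyUpTo-nth (parts Λ))

    conjugate-count : ∀ j → _
    conjugate-count j = count-decreasing (j ℕ.≤?_) (nth (parts Λ)) (l Λ)
      (λ i j≤ → ℕ.≤-trans j≤ (nth-antitone (decreasing Λ) i))

  -- With `conjugate-≤` this says that rows and columns agree on whether the box in row i + 1 and
  -- column j + 1 lies in the diagram.
  conjugate-< : ∀ {i j} → j < part Λ (suc i) → i < conjugatePart Λ (suc j)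
  conjugate-< {i} {j} j<λᵢ = ℕ.≰⇒> λ c≤i → proj₂ (conjugate-count (suc j))
    (≡.subst (_≤ i) (≡.sym (conjugatePart≡count (suc j))) c≤i)
    (ℕ.≰⇒> λ l≤i → ℕ.n≮0 (≡.subst (j <_) (part-beyond l≤i) j<λᵢ)) j<λᵢ

  conjugate-≤ : ∀ {i j} → part Λ (suc i) ≤ j → conjugatePart Λ (suc j) ≤ i
  conjugate-≤ {i} {j} λᵢ≤j = ℕ.≮⇒≥ λ i<c → ℕ.<-irrefl ≡.refl (ℕ.<-≤-trans
    (proj₁ (conjugate-count (suc j)) (≡.subst (i <_) (≡.sym (conjugatePart≡count (suc j))) i<c)) λᵢ≤j)

  private
    diagonal-count = count-decreasing (λ i → i ℕ.≤? part Λ i) suc (l Λ)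
      (λ i i+2≤ → ℕ.≤-trans (ℕ.n≤1+n _) (ℕ.≤-trans i+2≤ (nth-antitone (decreasing Λ) i)))

  diagonal-≤l : diagonal Λ ≤ l Λ
  diagonal-≤l = ℕ.≤-trans (List.length-filter (λ i → i ℕ.≤? part Λ i) (applyUpTo suc (l Λ)))
    (ℕ.≤-reflexive (List.length-applyUpTo suc (l Λ)))

  diagonal-inside : ∀ {i} → i < diagonal Λ → i < part Λ (suc i)
  diagonal-inside = proj₁ diagonal-count

  diagonal-outside : ∀ {i} → diagonal Λ ≤ i → part Λ (suc i) ≤ i
  diagonal-outside {i} r≤i with i ℕ.<? l Λ
  ... | yes i<l = ℕ.≮⇒≥ (proj₂ diagonal-count r≤i i<l)
  ... | no  i≮l rewrite part-beyond (ℕ.≮⇒≥ i≮l) = z≤n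

  -- The last row that meets the diagonal is long enough to reach column j + 1.
  conjugate-diagonal : ∀ {j} → j < diagonal Λ → diagonal Λ ≤ conjugatePart Λ (suc j)
  conjugate-diagonal {j} j<r with diagonal Λ | diagonal-inside
  ... | suc r | inside = conjugate-< (ℕ.<-≤-trans j<r (inside ℕ.≤-refl))

-- Hook functions and Hessenberg determinants.

module HookFunctions {c ℓ} (R : CommutativeRing c ℓ)
  (h : ℤ → ℤ → CommutativeRing.Carrier R)
  (unit : ∀ k → CommutativeRing._≈_ R (h k (ℤ.- k)) (CommutativeRing.1# R))
  (vanish : ∀ r k → k ℤ.+ r ℤ.< + 0 → CommutativeRing._≈_ R (h r k) (CommutativeRing.0# R)) where

  open CommutativeRing R hiding (zero)
  open Relation.Binary.Reasoning.Setoid setoid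
  open Determinant R
  open SymmetricFunctions R h
  open Columns R
  open IsAlternating

  U : ℕ → ℕ → Carrier
  U s r = h (+ r) (ℤ.- + s)

  U-vanish : ∀ {s r} → r < s → U s r ≈ 0#
  U-vanish {s} {r} r<s = vanish (+ r) (ℤ.- + s)
    (≡.subst (ℤ._< + 0) (≡.sym (ℤ.-m+n≡n⊖m s r)) (≡.subst (r ⊖ s ℤ.<_) (ℤ.n⊖n≡0 s) (ℤ.⊖-monoˡ-< s r<s)))

  -- e⁽⁻ᵖ⁾₋ₙ for n = p + m.
  E : ℕ → ℕ → Carrier
  E p m = D m (applyUpTo (λ t i → U (p ℕ.+ i) (p ℕ.+ suc t)) m)

  -- The difference p - a need not compute to a constructor, so here and in `elementary-suc` an
  -- equation selects the case of the definition.
  elementary-zero : ∀ p a → p ℤ.- a ≡ +0 → elementary p a ≈ 1#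
  elementary-zero p a eq with p ℤ.- a | eq
  ... | .+0 | ≡.refl = refl

  elementary-suc : ∀ p a d → p ℤ.- a ≡ +[1+ d ] →
    elementary p a ≈ det[ suc d ] (λ i j → h (ℤ.- p ℤ.+ + j) (p ℤ.+ + 1 ℤ.- + i))
  elementary-suc p a d eq with p ℤ.- a | eq
  ... | .(+[1+ d ]) | ≡.refl = refl

  private
    index-difference : ∀ p d → ℤ.- p ℤ.- ℤ.- (p ℤ.+ d) ≡ d
    index-difference = ℤ-Solver.solve-∀

    index-row : ∀ p i → ℤ.- p ℤ.+ + 1 ℤ.- (+ 1 ℤ.+ i) ≡ ℤ.- (p ℤ.+ i)
    index-row = ℤ-Solver.solve-∀

    index-column : ∀ p j → ℤ.- (ℤ.- p) ℤ.+ j ≡ p ℤ.+ j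
    index-column = ℤ-Solver.solve-∀

  applyUpTo-≋ : ∀ f g n → (∀ {j} → j < n → f j ≐ g j) → applyUpTo f n ≋ applyUpTo g n
  applyUpTo-≋ = Pointwise-applyUpTo⁺

  D-cong : ∀ m n f g → (∀ {j} → j < n → f j ≐ g j) → D m (applyUpTo f n) ≈ D m (applyUpTo g n)
  D-cong m n f g f≐g = D-alternating m .respects (applyUpTo-≋ f g n f≐g)

  elementary≈E : ∀ p m → elementary (ℤ.- + p) (ℤ.- + (p ℕ.+ m)) ≈ E p m
  elementary≈E p zero    = elementary-zero (ℤ.- + p) (ℤ.- + (p ℕ.+ zero)) (index-difference (+ p) +0)
  elementary≈E p (suc m) = begin
    elementary (ℤ.- + p) (ℤ.- + (p ℕ.+ suc m))
      ≈⟨ elementary-suc (ℤ.- + p) (ℤ.- + (p ℕ.+ suc m)) m (index-difference (+ p) +[1+ m ]) ⟩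
    det[ suc m ] (λ i j → h (ℤ.- (ℤ.- + p) ℤ.+ + j) (ℤ.- + p ℤ.+ + 1 ℤ.- + i))
      ≈⟨ det[]≈D (suc m) (λ i j → h (ℤ.- (ℤ.- + p) ℤ.+ + j) (ℤ.- + p ℤ.+ + 1 ℤ.- + i)) ⟩
    D (suc m) (applyUpTo (λ t i → h (ℤ.- (ℤ.- + p) ℤ.+ +[1+ t ]) (ℤ.- + p ℤ.+ + 1 ℤ.- +[1+ i ])) (suc m))
      ≈⟨ D-cong (suc m) (suc m) _ _ (λ {t} _ i → reflexive (≡.cong₂ h (index-column (+ p) +[1+ t ]) (index-row (+ p) (+ i)))) ⟩
    E p (suc m) ∎

  -- The coefficients `E p (n ∸ p)` do not depend on m, so all rows of a hook column are the same
  -- combination of the h⁽ᵖ⁾.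
  hook≈alt : ∀ m n → hook m (+ n) ≈ alt (suc n) (λ p → h (+ p) (m ℤ.+ + 1) * E p (n ∸ p))
  hook≈alt m n = trans
    (sum≈alt (suc n) (λ p → h (+ p) (m ℤ.+ + 1) * elementary (ℤ.- + p) (ℤ.- + n)))
    (alt-cong (suc n) λ { {p} (s≤s p≤n) → *-congˡ {h (+ p) (m ℤ.+ + 1)}
      (trans (reflexive (≡.cong (λ q → elementary (ℤ.- + p) (ℤ.- + q)) (≡.sym (ℕ.m+[n∸m]≡n p≤n))))
             (elementary≈E p (n ∸ p))) })

  -- Expansion along the first row; the minor of a column is block triangular with
  -- a unitriangular block, which the hypothesis on F removes.
  expand-hessenberg : ∀ (V : ℕ → ℕ → Carrier) →
    (∀ i → V i i ≈ 1#) → (∀ {i j} → j < i → V i j ≈ 0#) →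
    ∀ m (φ : ℕ → ℕ) F → (∀ {i j} → i < j → φ i < φ j) → (∀ ys → F ys ≈ D m (map (_∘ φ) ys)) →
    expand F (applyUpTo (λ t i → V i (suc (φ t))) (suc m))
    ≈ alt (suc m) (λ t → V 0 (suc (φ t)) *
        D (m ∸ t) (applyUpTo (λ t′ i → V (suc (φ (t ℕ.+ i))) (suc (φ (t ℕ.+ suc t′)))) (m ∸ t)))
  expand-hessenberg V V-unit V-vanish m φ F φ-mono F≈D = +-cong
    (*-congˡ (trans (F≈D _) (reflexive (≡.cong (D m) (≡.trans
      (≡.sym (List.map-∘ (applyUpTo (λ t i → V i (suc (φ (suc t)))) m)))
      (List.map-applyUpTo (λ t i → V i (suc (φ (suc t)))) ((_∘ φ) ∘ shift) m))))))
    (*-congˡ (rest m F≈D))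
    where
    rest : ∀ m → (∀ ys → F ys ≈ D m (map (_∘ φ) ys)) →
      expand (λ ys → F ((λ i → V (suc i) (suc (φ 0))) ∷ ys)) (applyUpTo (λ t i → V i (suc (φ (suc t)))) m)
      ≈ alt m (λ t → V 0 (suc (φ (suc t))) *
          D (m ∸ suc t) (applyUpTo (λ t′ i → V (suc (φ (suc (t ℕ.+ i)))) (suc (φ (suc (t ℕ.+ suc t′))))) (m ∸ suc t)))
    rest zero    F≈D = refl
    -- φ lists the rows still present. On them the column just passed over is (1, 0, 0, ...), so it
    -- drops out together with row `φ 0`.
    rest (suc m) F≈D = expand-hessenberg V V-unit V-vanish m (φ ∘ suc) _ (φ-mono ∘ s<s) (λ ys → begin
      F ((λ i → V (suc i) (suc (φ 0))) ∷ ys)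
        ≈⟨ F≈D _ ⟩
      D (suc m) ((λ i → V (suc (φ i)) (suc (φ 0))) ∷ map (_∘ φ) ys)
        ≈⟨ D-unit-column m (λ i → V (suc (φ i)) (suc (φ 0))) _ (V-unit _) (λ i → V-vanish (s<s (φ-mono z<s))) ⟩
      D m (map shift (map (_∘ φ) ys))
        ≡⟨ ≡.cong (D m) (List.map-∘ ys) ⟨
      D m (map (_∘ (φ ∘ suc)) ys) ∎)

  -- Up to sign this is an off-diagonal entry of U U⁻¹ = 1, solved for the term at the diagonal of
  -- U.
  E-suc : ∀ p m → E p (suc m) ≈ alt (suc m) (λ t → U p (p ℕ.+ suc t) * E (p ℕ.+ suc t) (m ∸ t))
  E-suc p m = trans
    (expand-hessenberg V (λ i → unit (+ (p ℕ.+ i))) (U-vanish ∘ ℕ.+-monoʳ-< p)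
      m id (D m) id (λ ys → reflexive (≡.cong (D m) (≡.sym (List.map-id ys)))))
    (alt-cong (suc m) λ {t} _ → *-cong
      (reflexive (≡.cong (λ q → U q (p ℕ.+ suc t)) (ℕ.+-identityʳ p)))
      (D-cong (m ∸ t) (m ∸ t) _ _ λ {t′} _ i → reflexive (≡.cong₂ U
        (≡.sym (ℕ.+-assoc p (suc t) i))
        (≡.sym (ℕ.+-assoc p (suc t) (suc t′))))))
    where
    V : ℕ → ℕ → Carrier
    V i j = U (p ℕ.+ i) (p ℕ.+ j)

  -- Orthogonality: hooks with negative arm.

  private
    orthogonality-term : ℕ → ℕ → ℕ → Carrier
    orthogonality-term s n p = U s p * E p (n ∸ p)

    term-vanish : ∀ {s} n {p} → p < s → orthogonality-term s n p ≈ 0#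
    term-vanish n p<s = trans (*-congʳ (U-vanish p<s)) (zeroˡ _)

  -- For arm -1 - s the subscript of h is -s, so the h⁽ᵖ⁾ form row s of U.
  hook-negative : ∀ s n → hook -[1+ s ] (+ n) ≈ alt (suc n) (λ p → U s p * E p (n ∸ p))
  hook-negative s n = trans (hook≈alt -[1+ s ] n)
    (alt-cong (suc n) λ {p} _ → *-congʳ {E p (n ∸ p)} (reflexive (≡.cong (h (+ p)) (index s))))
    where
    index : ∀ s → -[1+ s ] ℤ.+ + 1 ≡ ℤ.- + s
    index zero    = ≡.refl
    index (suc s) = ≡.refl

  hook-negative-diagonal : ∀ s → hook -[1+ s ] (+ s) ≈ sgn s
  hook-negative-diagonal s = begin
    hook -[1+ s ] (+ s)
      ≈⟨ hook-negative s s ⟩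
    alt (suc s) (orthogonality-term s s)
      ≈⟨ alt-last s _ ⟩
    alt s (orthogonality-term s s) + sgn s * (U s s * E s (s ∸ s))
      ≈⟨ +-cong (alt-zero s (term-vanish s)) (*-congˡ (*-cong (unit (+ s)) (reflexive (≡.cong (E s) (ℕ.n∸n≡0 s))))) ⟩
    0# + sgn s * (1# * 1#)
      ≈⟨ trans (+-identityˡ _) (trans (*-congˡ (*-identityˡ 1#)) (*-identityʳ _)) ⟩
    sgn s ∎

  -- The sum ends before it reaches the diagonal of U.
  hook-negative-above : ∀ {s n} → n < s → hook -[1+ s ] (+ n) ≈ 0#
  hook-negative-above {s} {n} n<s = trans (hook-negative s n)
    (alt-zero (suc n) λ { (s≤s p≤n) → term-vanish n (ℕ.≤-<-trans p≤n n<s) })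

  hook-negative-below : ∀ {s n} → s < n → hook -[1+ s ] (+ n) ≈ 0#
  hook-negative-below {s} {n} s<n with ℕ.m≤n⇒∃[o]m+o≡n s<n
  ... | d , ≡.refl = begin
    hook -[1+ s ] (+ suc (s ℕ.+ d))
      ≈⟨ hook-negative s (suc (s ℕ.+ d)) ⟩
    alt (suc (suc (s ℕ.+ d))) g
      ≡⟨ ≡.cong (λ q → alt q g) (≡.trans (≡.sym (ℕ.+-suc (suc s) d)) (≡.sym (ℕ.+-suc s (suc d)))) ⟩
    alt (s ℕ.+ suc (suc d)) g
      ≈⟨ alt-skip s (suc (suc d)) g (term-vanish _) ⟩
    sgn s * (g (s ℕ.+ 0) + ε * alt (suc d) (λ t → g (s ℕ.+ suc t)))
      -- Left of the diagonal the terms vanish. The diagonal term is `E s (suc d)`, and the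
      -- remaining ones sum to the same value by `E-suc`.
      ≈⟨ *-congˡ (+-cong first (*-congˡ others)) ⟩
    sgn s * (E s (suc d) + ε * E s (suc d))
      ≈⟨ *-congˡ (x+εx≈0 _) ⟩
    sgn s * 0#
      ≈⟨ zeroʳ _ ⟩
    0# ∎
    where
    g : ℕ → Carrier
    g = orthogonality-term s (suc (s ℕ.+ d))

    difference : ∀ t → suc (s ℕ.+ d) ∸ (s ℕ.+ t) ≡ suc d ∸ t
    difference t = ≡.trans (≡.cong (_∸ (s ℕ.+ t)) (≡.sym (ℕ.+-suc s d))) (ℕ.[m+n]∸[m+o]≡n∸o s (suc d) t)

    first : g (s ℕ.+ 0) ≈ E s (suc d)
    first = begin
      U s (s ℕ.+ 0) * E (s ℕ.+ 0) (suc (s ℕ.+ d) ∸ (s ℕ.+ 0))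
        ≡⟨ ≡.cong₂ (λ q k → U s q * E q k) (ℕ.+-identityʳ s) (difference 0) ⟩
      U s s * E s (suc d)
        ≈⟨ trans (*-congʳ (unit (+ s))) (*-identityˡ _) ⟩
      E s (suc d) ∎

    others : alt (suc d) (λ t → g (s ℕ.+ suc t)) ≈ E s (suc d)
    others = trans
      (alt-cong (suc d) λ {t} _ → *-congˡ {U s (s ℕ.+ suc t)} (reflexive (≡.cong (E (s ℕ.+ suc t)) (difference (suc t)))))
      (sym (E-suc s d))

  -- Determinants attached to a partition.

  module _ (Λ : Partition) where

    row : ℕ → ℤ
    row i = + part Λ (suc i) ℤ.- + suc i

    h-column : ℕ → Column
    h-column p i = h (+ p) (row i ℤ.+ + 1)

    hook-column : ℤ → Column
    hook-column b i = hook (row i) b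

    -- Each zero part appends a row of U: zeros, then 1 in the new last column.
    schur-stable : ∀ m → schur Λ ≈ D (m ℕ.+ l Λ) (applyUpTo h-column (m ℕ.+ l Λ))
    schur-stable zero    = det[]≈D (l Λ) (λ i j → h (+ j ℤ.- + 1) (+ part Λ i ℤ.- + i ℤ.+ + 1))
    schur-stable (suc m) = begin
      schur Λ                                          ≈⟨ schur-stable m ⟩
      D n (applyUpTo h-column n)                       ≈⟨ *-identityˡ _ ⟨
      1# * D n (applyUpTo h-column n)                  ≈⟨ *-congʳ (trans (entry n) (unit (+ n))) ⟨
      h-column n n * D n (applyUpTo h-column n)        ≈⟨ D-last-row n _ (h-column n) (All.applyUpTo⁺₁ h-column n λ {p} p<n → trans (entry p) (U-vanish p<n)) ⟨
      D (suc n) (applyUpTo h-column n ∷ʳ h-column n)   ≡⟨ ≡.cong (D (suc n)) (List.applyUpTo-∷ʳ h-column n) ⟩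
      D (suc n) (applyUpTo h-column (suc n))           ∎
      where
      n = m ℕ.+ l Λ

      index : ∀ n → +0 ℤ.- (+ 1 ℤ.+ n) ℤ.+ + 1 ≡ ℤ.- n
      index = ℤ-Solver.solve-∀

      entry : ∀ p → h-column p n ≈ U n p
      entry p = reflexive (≡.cong (h (+ p))
        (≡.trans (≡.cong (λ k → + k ℤ.- + suc n ℤ.+ + 1) (part-beyond Λ (ℕ.m≤n+m (l Λ) m))) (index (+ n))))

    schur≈hooks : ∀ {n} → l Λ ≤ n →
      schur Λ ≈ det[ n ] (λ i j → hook (+ part Λ i ℤ.- + i) (+ n ℤ.- + j))
    schur≈hooks {n} l≤n = begin
      schur Λ
        ≈⟨ schur-stable (n ∸ l Λ) ⟩
      D (n ∸ l Λ ℕ.+ l Λ) (applyUpTo h-column (n ∸ l Λ ℕ.+ l Λ))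
        ≡⟨ ≡.cong (λ k → D k (applyUpTo h-column k)) (ℕ.m∸n+n≡m l≤n) ⟩
      D n (applyUpTo h-column n)
        -- The leading coefficients are the empty determinants `E q 0`, equal to 1.
        ≈⟨ triangular-reversal (D-alternating n) h-column (hook-column ∘ +_) (λ p n → E p (n ∸ p)) n
             (λ q → reflexive (≡.cong (E q) (ℕ.n∸n≡0 q))) (λ q i → hook≈alt (row i) q) ⟨
      D n (applyDownFrom (hook-column ∘ +_) n)
        ≡⟨ ≡.cong (D n) (applyDownFrom≡applyUpTo (hook-column ∘ +_) n) ⟩
      D n (applyUpTo (λ j → hook-column (+ (n ∸ suc j))) n)
        ≈⟨ D-cong n n _ _ (λ j<n i → reflexive (≡.cong (λ b → hook (row i) b) (ℤ.⊖-≥ j<n))) ⟨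
      D n (applyUpTo (λ j → hook-column (+ n ℤ.- + suc j)) n)
        ≈⟨ det[]≈D n (λ i j → hook (+ part Λ i ℤ.- + i) (+ n ℤ.- + j)) ⟨
      det[ n ] (λ i j → hook (+ part Λ i ℤ.- + i) (+ n ℤ.- + j)) ∎

    -- These interpolate between n - j at i = n and the Frobenius coordinate βⱼ at i = r.
    leg : ℕ → ℕ → ℤ
    leg i j = + (conjugatePart Λ (suc j) ⊔ i) ℤ.- + suc j

    truncation : ℕ → Carrier
    truncation i = D i (applyUpTo (hook-column ∘ leg i) i)

    -- Row i + 1 = c + q + 1 lies below the diagonal; it is supported on column c + 1, where c is the
    -- length of the row, and its entry there, sgn q, is also the sign of that cofactor.
    truncation-suc : ∀ {i} → diagonal Λ ≤ i → truncation (suc i) ≈ truncation i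
    truncation-suc {i} r≤i with part Λ (suc i) in λᵢ≡c | ℕ.m≤n⇒∃[o]m+o≡n (diagonal-outside Λ r≤i)
    ... | c | q , ≡.refl = begin
      D (suc i) (applyUpTo column (suc i))
        ≡⟨ ≡.cong (λ k → D (suc i) (applyUpTo column k)) (ℕ.+-suc c q) ⟨
      D (suc i) (applyUpTo column (c ℕ.+ suc q))
        ≡⟨ ≡.cong (D (suc i)) (applyUpTo-+ column c (suc q)) ⟩
      D (suc i) (left ++ column (c ℕ.+ 0) ∷ right)
        -- Row i has arm -1 - q. Columns before c extend past this row of the diagram, so their legs
        -- exceed q; column c + t has leg q - t.
        ≈⟨ D-row i left (column (c ℕ.+ 0)) right
             (All.applyUpTo⁺₁ column c λ j<c → trans (left-entry j<c) (hook-negative-below (left-leg-large j<c)))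
             (All.applyUpTo⁺₁ (λ t → column (c ℕ.+ suc t)) q λ {t} t<q →
               trans (right-entry (suc t) t<q) (hook-negative-above (ℕ.∸-monoʳ-< z<s t<q))) ⟩
      sgn (length right) * (column (c ℕ.+ 0) i * D i (left ++ right))
        ≡⟨ ≡.cong (λ k → sgn k * (column (c ℕ.+ 0) i * D i (left ++ right)))
             (List.length-applyUpTo (λ t → column (c ℕ.+ suc t)) q) ⟩
      sgn q * (column (c ℕ.+ 0) i * D i (left ++ right))
        ≈⟨ *-congˡ (*-congʳ (trans (right-entry 0 z≤n) (hook-negative-diagonal q))) ⟩
      sgn q * (sgn q * D i (left ++ right))
        ≈⟨ sgn-cancel q _ ⟩
      D i (left ++ right)
        -- Left legs are conjugate parts in both truncations. On the right the column index and the
        -- truncation both drop by 1, so the legs again agree.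
        ≈⟨ D-alternating i .respects (Pointwise.++⁺
             (applyUpTo-≋ _ _ c λ j<c k → reflexive (≡.cong (hook (row k)) (left-leg j<c)))
             (applyUpTo-≋ _ _ q λ {t} _ k → reflexive (≡.cong (hook (row k)) (right-leg t)))) ⟩
      D i (applyUpTo (hook-column ∘ leg i) c ++ applyUpTo (λ t → hook-column (leg i (c ℕ.+ t))) q)
        ≡⟨ ≡.cong (D i) (applyUpTo-+ (hook-column ∘ leg i) c q) ⟨
      D i (applyUpTo (hook-column ∘ leg i) i) ∎
      where
      column : ℕ → Column
      column = hook-column ∘ leg (suc i)

      left right : List Column
      left  = applyUpTo column c
      right = applyUpTo (λ t → column (c ℕ.+ suc t)) q

      row≡ : row i ≡ -[1+ q ]
      row≡ = ≡.trans (≡.cong (_⊖ suc i) λᵢ≡c) (≡.trans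
        (≡.cong₂ _⊖_ (≡.sym (ℕ.+-identityʳ c)) (≡.sym (ℕ.+-suc c q)))
        (ℤ.+-cancelˡ-⊖ c 0 (suc q)))

      i<conjugate : ∀ {j} → j < c → i < conjugatePart Λ (suc j)
      i<conjugate j<c = conjugate-< Λ (≡.subst (_ <_) (≡.sym λᵢ≡c) j<c)

      conjugate≤i : ∀ t → conjugatePart Λ (suc (c ℕ.+ t)) ≤ i
      conjugate≤i t = conjugate-≤ Λ (≡.subst (_≤ c ℕ.+ t) (≡.sym λᵢ≡c) (ℕ.m≤m+n c t))

      left-leg : ∀ {j} → j < c → leg (suc i) j ≡ leg i j
      left-leg {j} j<c = ≡.cong (_⊖ suc j) (≡.trans
        (ℕ.m≥n⇒m⊔n≡m (i<conjugate j<c)) (≡.sym (ℕ.m≥n⇒m⊔n≡m (ℕ.<⇒≤ (i<conjugate j<c)))))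

      right-leg : ∀ t → leg (suc i) (c ℕ.+ suc t) ≡ leg i (c ℕ.+ t)
      right-leg t = ≡.trans
        (≡.cong₂ (λ a b → a ⊖ suc b) (ℕ.m≤n⇒m⊔n≡n (ℕ.m≤n⇒m≤1+n (conjugate≤i (suc t)))) (ℕ.+-suc c t))
        (≡.trans (ℤ.[1+m]⊖[1+n]≡m⊖n i (suc (c ℕ.+ t)))
                 (≡.cong (_⊖ suc (c ℕ.+ t)) (≡.sym (ℕ.m≤n⇒m⊔n≡n (conjugate≤i t)))))

      left-leg-large : ∀ {j} → j < c → q < conjugatePart Λ (suc j) ∸ suc j
      left-leg-large {j} j<c = ℕ.m+n≤o⇒m≤o∸n (suc q) (ℕ.≤-trans (ℕ.+-monoʳ-≤ (suc q) j<c)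
        (≡.subst (_≤ conjugatePart Λ (suc j)) (≡.cong suc (ℕ.+-comm c q)) (i<conjugate j<c)))

      left-entry : ∀ {j} → j < c → column j i ≈ hook -[1+ q ] (+ (conjugatePart Λ (suc j) ∸ suc j))
      left-entry {j} j<c = reflexive (≡.cong₂ hook row≡ (≡.trans
        (≡.cong (_⊖ suc j) (ℕ.m≥n⇒m⊔n≡m (i<conjugate j<c)))
        (ℤ.⊖-≥ (ℕ.≤-trans j<c (ℕ.≤-trans (ℕ.m≤m+n c q) (ℕ.<⇒≤ (i<conjugate j<c)))))))

      right-entry : ∀ t → t ≤ q → column (c ℕ.+ t) i ≈ hook -[1+ q ] (+ (q ∸ t))
      right-entry t t≤q = reflexive (≡.cong₂ hook row≡ (≡.trans
        (≡.cong (_⊖ suc (c ℕ.+ t)) (ℕ.m≤n⇒m⊔n≡n (ℕ.m≤n⇒m≤1+n (conjugate≤i t))))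
        (≡.trans (ℤ.[1+m]⊖[1+n]≡m⊖n i (c ℕ.+ t)) (≡.trans (ℤ.+-cancelˡ-⊖ c q t) (ℤ.⊖-≥ t≤q)))))

    truncation-constant : ∀ m → truncation (m ℕ.+ diagonal Λ) ≈ truncation (diagonal Λ)
    truncation-constant zero    = refl
    truncation-constant (suc m) = trans (truncation-suc (ℕ.m≤n+m (diagonal Λ) m)) (truncation-constant m)

    hooks≈frobenius : ∀ {n} → l Λ ≤ n →
      det[ n ] (λ i j → hook (+ part Λ i ℤ.- + i) (+ n ℤ.- + j))
      ≈ det[ diagonal Λ ] (λ i j → hook (α Λ i) (β Λ j))
    hooks≈frobenius {n} l≤n = begin
      det[ n ] (λ i j → hook (+ part Λ i ℤ.- + i) (+ n ℤ.- + j))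
        ≈⟨ det[]≈D n (λ i j → hook (+ part Λ i ℤ.- + i) (+ n ℤ.- + j)) ⟩
      D n (applyUpTo (λ j → hook-column (+ n ℤ.- + suc j)) n)
        -- Conjugate parts are at most n, so the maximum in `leg n` is n.
        ≈⟨ D-cong n n _ _ (λ {j} _ i → reflexive (≡.cong (λ k → hook (row i) (k ⊖ suc j))
             (ℕ.m≤n⇒m⊔n≡n (ℕ.≤-trans (conjugatePart≤l Λ (suc j)) l≤n)))) ⟨
      truncation n
        ≡⟨ ≡.cong truncation (ℕ.m∸n+n≡m (ℕ.≤-trans (diagonal-≤l Λ) l≤n)) ⟨
      truncation (n ∸ r ℕ.+ r)
        ≈⟨ truncation-constant (n ∸ r) ⟩
      truncation r
        -- The first r conjugate parts are at least r, so here the maximum is the conjugate part.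
        ≈⟨ D-cong r r _ _ (λ {j} j<r i → reflexive (≡.cong (λ k → hook (row i) (k ⊖ suc j))
             (ℕ.m≥n⇒m⊔n≡m (conjugate-diagonal Λ j<r)))) ⟩
      D r (applyUpTo (λ j → hook-column (β Λ (suc j))) r)
        ≈⟨ det[]≈D r (λ i j → hook (α Λ i) (β Λ j)) ⟨
      det[ r ] (λ i j → hook (α Λ i) (β Λ j)) ∎
      where r = diagonal Λ

-- Specialization to the polynomial ring.

open Defs using (det[_]; schur; hook)

theorem3p1 : (h : ℤ → ℤ → B) → IsGeneralizedFamily h →
    (Λ : Partition) (n : ℕ) → l Λ ≤ n →
    (schur h Λ ≈ᴾ det[ n ] (λ i j → hook h (+ part Λ i - + i) (+ n - + j)))
    × (det[ n ] (λ i j → hook h (+ part Λ i - + i) (+ n - + j))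
    ≈ᴾ det[ diagonal Λ ] (λ i j → hook h (α Λ i) (β Λ j)))
theorem3p1 h family Λ n l≤n = schur≈hooks Λ l≤n , hooks≈frobenius Λ l≤n
  where
  open IsGeneralizedFamily family
  open HookFunctions polynomialRing h unit vanish
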